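{- For every $n\ge2$, $$LLT_n[X;q]\;=\;\sum_{k=1}^n(-1)^{k-1}(q;q)_{k-1}\begin{bmatrix}n-1\\k-1\end{bmatrix}_q e_k[X]\;LLT_{n-k}[X;q].$$
   Context: $(q;q)_k=(1-q)\cdots(1-q^k)$, and $\begin{bmatrix}n\\k\end{bmatrix}_q=\frac{(q;q)_n}{(q;q)_k(q;q)_{n-k}}$ is the $q$-binomial coefficient. For $m\ge1$, $LLT_m[X;q]$ is the LLT polynomial $LLT_D[X;q]$ of the zero-area Dyck path $D=(NE)^m$ in the $m\times m$ lattice square, and $LLT_0=1$. The LLT polynomial of a Dyck path $D$ in the $m\times m$ square is defined as follows. Let $a_i$ be the number of full cells in row $i$ between $D$ and the diagonal. A parking function on $D$ labels the cells right of the North steps bijectively by cars $1,\dots,m$, increasing up columns; $c_i$ is the car in row $i$. Pairs of rows $i<j$ give a dinv if either $a_i=a_j$ and $c_i<c_j$, or $a_i=a_j+1$ and $c_i>c_j$; $\mathrm{dinv}(PF)$ counts these. $\sigma(PF)$ reads the cars by diagonals from highest to lowest, each diagonal from right to left. $\mathrm{pides}(PF)$ is the composition encoding the descent set of $\sigma(PF)^{ -1}$. Then $LLT_D[X;q]=\sum_{PF}q^{\mathrm{dinv}(PF)}F_{\mathrm{pides}(PF)}[X]$, with $F_\alpha$ Gessel's fundamental quasisymmetric functions. (Equivalently, $LLT_m[X;q]=(q;q)_m\,h_m[X/(1-q)]$ in plethystic notation.) -}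

module Defs where

open import Data.Bool.Base using (if_then_else_)
open import Data.Fin.Base as Fin using (Fin; toℕ)
import Data.Fin.Properties as Fin
open import Data.Integer.Base as ℤ using (ℤ; +_; 0ℤ; 1ℤ; -1ℤ)
open import Data.List.Base as List using
  (List; []; _∷_; map; foldr; filter; length; upTo; downFrom; allFin; reverse;
   concatMap; cartesianProduct; cartesianProductWith; replicate)
import Data.List.Properties as List
import Data.List.Membership.DecPropositional as DecMembership
open import Data.List.Membership.Propositional using (_∈_)
open import Data.Nat.Base as ℕ using (ℕ; zero; suc; _∸_)
import Data.Nat.ListAction as ℕ
import Data.Nat.Properties as ℕ
open import Data.Product.Base using (_×_; _,_)
open import Data.Sum.Base using (_⊎_)
open import Data.Vec.Base as Vec using (Vec; []; _∷_; lookup; count)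
open import Relation.Binary.PropositionalEquality.Core using (_≡_)
open import Relation.Nullary.Decidable.Core using
  (Dec; does; _×-dec_; _⊎-dec_; _→-dec_)

private variable
  A I : Set
  d m n r : ℕ

------------------------------------------------------------------------
-- Coefficients: ℤ[[q]].  It contains ℤ[q], and every (q;q)ₖ is a unit in
-- it, so that the quotient of q-factorials can be written as a quotient.

ℤ⟦q⟧ : Set
ℤ⟦q⟧ = ℕ → ℤ

∑ℤ : List I → (I → ℤ) → ℤ
∑ℤ is f = foldr (λ i s → f i ℤ.+ s) 0ℤ is

infixl 6 _⊕_ _⊖_
infixl 7 _⊗_ _⊘_

const : ℤ → ℤ⟦q⟧
const c zero    = c
const c (suc _) = 0ℤ

q^_ : ℕ → ℤ⟦q⟧
(q^ k) n = if does (n ℕ.≟ k) then 1ℤ else 0ℤ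

_⊕_ _⊖_ _⊗_ : ℤ⟦q⟧ → ℤ⟦q⟧ → ℤ⟦q⟧
(f ⊕ g) n = f n ℤ.+ g n
(f ⊖ g) n = f n ℤ.- g n
(f ⊗ g) n = ∑ℤ (upTo (suc n)) λ i → f i ℤ.* g (n ∸ i)

∑ : List I → (I → ℤ⟦q⟧) → ℤ⟦q⟧
∑ is f = foldr (λ i s → f i ⊕ s) (const 0ℤ) is

pow : ℤ⟦q⟧ → ℕ → ℤ⟦q⟧
pow f zero    = const 1ℤ
pow f (suc k) = f ⊗ pow f k

-- The inverse 1/g = ∑ₖ (1 - g)ᵏ of a series g with constant term 1 (the
-- only kind it is used for); the k-th summand starts in degree ≥ k, so only
-- k ≤ n contribute to the coefficient of qⁿ.
recip : ℤ⟦q⟧ → ℤ⟦q⟧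
recip g n = ∑ (upTo (suc n)) (pow (const 1ℤ ⊖ g)) n

_⊘_ : ℤ⟦q⟧ → ℤ⟦q⟧ → ℤ⟦q⟧
f ⊘ g = f ⊗ recip g

-- (q;q)ₖ
qPoch : ℕ → ℤ⟦q⟧
qPoch zero    = const 1ℤ
qPoch (suc k) = qPoch k ⊗ (const 1ℤ ⊖ q^ suc k)

-- Meant for k ≤ n only.
qbinom : ℕ → ℕ → ℤ⟦q⟧
qbinom n k = qPoch n ⊘ (qPoch k ⊗ qPoch (n ∸ k))

------------------------------------------------------------------------
-- Formal power series in X = x₁, x₂, x₃, … over ℤ[[q]].  The exponent list
-- β₁ ∷ … ∷ β_ℓ ∷ [] stands for the monomial x₁^β₁ ⋯ x_ℓ^β_ℓ; ℓ is arbitrary,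
-- so every monomial is covered (repeatedly, up to trailing zeros).  A series
-- is given by its coefficients.

Monomial : Set
Monomial = List ℕ

Series : Set
Series = Monomial → ℤ⟦q⟧

infix  4 _≈_
infixr 7 _•_
infixl 6 _⊞_
infixl 7 _⊠_

_≈_ : Series → Series → Set
f ≈ g = ∀ β k → f β k ≡ g β k

𝟘 𝟙 : Series
𝟘 β = const 0ℤ
𝟙 β = if does (List.≡-dec ℕ._≟_ β (replicate (length β) 0))
      then const 1ℤ else const 0ℤ

_⊞_ : Series → Series → Series
(f ⊞ g) β = f β ⊕ g β

_•_ : ℤ⟦q⟧ → Series → Series
(c • f) β = c ⊗ f β

-- All factorisations of a monomial into two monomials.
factorisations : Monomial → List (Monomial × Monomial)
factorisations []      = ([] , []) ∷ []
factorisations (b ∷ β) =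
  cartesianProductWith (λ { i (γ , δ) → (i ∷ γ , (b ∸ i) ∷ δ) })
    (upTo (suc b)) (factorisations β)

_⊠_ : Series → Series → Series
(f ⊠ g) β = ∑ (factorisations β) λ { (γ , δ) → f γ ⊗ g δ }

∑ₓ : List I → (I → Series) → Series
∑ₓ is f = foldr (λ i s → f i ⊞ s) 𝟘 is

------------------------------------------------------------------------
-- Series given as sums of x_{i₁} ⋯ x_{iₙ} over some index words i₁ … iₙ.

words : List A → ∀ n → List (Vec A n)
words as zero    = [] ∷ []
words as (suc n) = cartesianProductWith _∷_ as (words as n)

-- x_{w₁} ⋯ x_{wₙ} = x^β
HasMonomial : (β : Monomial) → Vec (Fin (length β)) n → Set
HasMonomial β w = ∀ v → count (Fin._≟ v) w ≡ List.lookup β v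

hasMonomial? : (β : Monomial) (w : Vec (Fin (length β)) n) →
               Dec (HasMonomial β w)
hasMonomial? β w = Fin.all? λ v → count (Fin._≟ v) w ℕ.≟ List.lookup β v

-- ∑ x_{w₁} ⋯ x_{wₙ} over the words w satisfying P.  The coefficient at β
-- counts words, and only indices ≤ length β can occur in them.
sumOfWords : ∀ n (P : ∀ {ℓ} → Vec (Fin ℓ) n → Set) →
             (∀ {ℓ} (w : Vec (Fin ℓ) n) → Dec (P w)) → Series
sumOfWords n P P? β = const (+ length
  (filter (λ w → hasMonomial? β w ×-dec P? w)
          (words (allFin (length β)) n)))

StrictlyIncreasing : ∀ {ℓ} → Vec (Fin ℓ) n → Set
StrictlyIncreasing w = ∀ i j → i Fin.< j → lookup w i Fin.< lookup w j

strictlyIncreasing? : ∀ {ℓ} (w : Vec (Fin ℓ) n) → Dec (StrictlyIncreasing w)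
strictlyIncreasing? w = Fin.all? λ i → Fin.all? λ j →
  (i Fin.<? j) →-dec (lookup w i Fin.<? lookup w j)

e : ℕ → Series
e k = sumOfWords k StrictlyIncreasing strictlyIncreasing?

Composition : Set
Composition = List ℕ

-- α₁, α₁+α₂, …, α₁+⋯+α_{l-1}
partialSums : Composition → List ℕ
partialSums []          = []
partialSums (a ∷ [])    = []
partialSums (a ∷ b ∷ α) = a ∷ map (a ℕ.+_) (partialSums (b ∷ α))

-- i₁ ≤ ⋯ ≤ iₙ, with i_s < i_{s+1} whenever s ∈ S.  For consecutive 0-based
-- positions j, k, the 1-based position of the left one is s = toℕ k.
FundamentalWord : List ℕ → ∀ {ℓ} → Vec (Fin ℓ) n → Set
FundamentalWord S w = ∀ j k → toℕ k ≡ suc (toℕ j) →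
  lookup w j Fin.≤ lookup w k × (toℕ k ∈ S → lookup w j Fin.< lookup w k)

fundamentalWord? : ∀ S {ℓ} (w : Vec (Fin ℓ) n) → Dec (FundamentalWord S w)
fundamentalWord? S w = Fin.all? λ j → Fin.all? λ k →
  (toℕ k ℕ.≟ suc (toℕ j)) →-dec
    ((lookup w j Fin.≤? lookup w k) ×-dec
     ((toℕ k ∈? S) →-dec (lookup w j Fin.<? lookup w k)))
  where open DecMembership ℕ._≟_ using (_∈?_)

-- Gessel's fundamental quasisymmetric function
F : Composition → Series
F α = sumOfWords (ℕ.sum α) (FundamentalWord (partialSums α))
                           (fundamentalWord? (partialSums α))

------------------------------------------------------------------------
-- Dyck paths.  DyckFrom d r: the ways to complete a path which currently
-- has d more N than E steps and still has r N steps to take.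

data DyckFrom : ℕ → ℕ → Set where
  end : DyckFrom 0 0
  N   : DyckFrom (suc d) r → DyckFrom d (suc r)
  E   : DyckFrom d r → DyckFrom (suc d) r

DyckPath : ℕ → Set
DyckPath = DyckFrom 0

-- (NE)ᵐ
zeroAreaPath : ∀ m → DyckPath m
zeroAreaPath zero    = end
zeroAreaPath (suc m) = N (E (zeroAreaPath m))

-- The numbers aᵢ of full cells between path and diagonal, rows listed from
-- the bottom: before the N step of row i there were i - 1 N steps and
-- i - 1 - aᵢ E steps, i.e. aᵢ is the current excess d.
area : DyckFrom d r → Vec ℕ r
area end           = []
area (N {d = d} p) = d ∷ area p
area (E p)         = area p

-- The column of the cell right of each N step, x being the current abscissa.
columnsFrom : ℕ → DyckFrom d r → Vec ℕ r
columnsFrom x end   = []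
columnsFrom x (N p) = x ∷ columnsFrom x p
columnsFrom x (E p) = columnsFrom (suc x) p

columns : DyckPath m → Vec ℕ m
columns = columnsFrom 0

------------------------------------------------------------------------
-- Parking functions.  Rows and cars 1, …, m are represented by Fin m; a
-- labelling is the vector c of cars by row.

Labelling : ℕ → Set
Labelling m = Vec (Fin m) m

-- Injective, hence bijective, and increasing up columns.
IsParkingFunction : DyckPath m → Labelling m → Set
IsParkingFunction D c =
    (∀ i j → lookup c i ≡ lookup c j → i ≡ j)
  × (∀ i j → i Fin.< j → lookup (columns D) i ≡ lookup (columns D) j →
       lookup c i Fin.< lookup c j)

isParkingFunction? : (D : DyckPath m) (c : Labelling m) →
                     Dec (IsParkingFunction D c)
isParkingFunction? D c =
  (Fin.all? λ i → Fin.all? λ j →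
     (lookup c i Fin.≟ lookup c j) →-dec (i Fin.≟ j))
  ×-dec
  (Fin.all? λ i → Fin.all? λ j →
     (i Fin.<? j) →-dec
     ((lookup (columns D) i ℕ.≟ lookup (columns D) j) →-dec
      (lookup c i Fin.<? lookup c j)))

parkingFunctions : DyckPath m → List (Labelling m)
parkingFunctions {m} D = filter (isParkingFunction? D) (words (allFin m) m)

IsDinv : DyckPath m → Labelling m → Fin m × Fin m → Set
IsDinv D c (i , j) = i Fin.< j ×
  ( (lookup (area D) i ≡ lookup (area D) j × lookup c i Fin.< lookup c j)
  ⊎ (lookup (area D) i ≡ suc (lookup (area D) j) ×
     lookup c j Fin.< lookup c i))

isDinv? : (D : DyckPath m) (c : Labelling m) → ∀ ij → Dec (IsDinv D c ij)
isDinv? D c (i , j) = (i Fin.<? j) ×-dec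
  (((lookup (area D) i ℕ.≟ lookup (area D) j) ×-dec
    (lookup c i Fin.<? lookup c j))
   ⊎-dec
   ((lookup (area D) i ℕ.≟ suc (lookup (area D) j)) ×-dec
    (lookup c j Fin.<? lookup c i)))

dinv : DyckPath m → Labelling m → ℕ
dinv {m} D c =
  length (filter (isDinv? D c) (cartesianProduct (allFin m) (allFin m)))

-- Diagonals a = m-1, …, 0; right to left in a diagonal is from the top row
-- to the bottom row.
readingOrder : DyckPath m → List (Fin m)
readingOrder {m} D = concatMap
  (λ a → filter (λ i → lookup (area D) i ℕ.≟ a) (reverse (allFin m)))
  (downFrom m)

σ : DyckPath m → Labelling m → List (Fin m)
σ D c = map (lookup c) (readingOrder D)

position : Fin m → List (Fin m) → ℕ
position v []      = 0
position v (x ∷ w) = if does (x Fin.≟ v) then 0 else suc (position v w)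

-- One-line notation of the inverse of a permutation, with 0-based values.
inverse : List (Fin m) → List ℕ
inverse {m} w = map (λ v → position v w) (allFin m)

-- The s with w_s > w_{s+1}, in increasing order; the first letter of the
-- argument has index s.
descentsFrom : ℕ → List ℕ → List ℕ
descentsFrom s []          = []
descentsFrom s (x ∷ [])    = []
descentsFrom s (x ∷ y ∷ w) =
  if does (y ℕ.<? x) then s ∷ descentsFrom (suc s) (y ∷ w)
                     else descentsFrom (suc s) (y ∷ w)

descents : List ℕ → List ℕ
descents = descentsFrom 1

-- s₁ < ⋯ < s_l ↦ (s₁ - p, s₂ - s₁, …, m - s_l)
gaps : ℕ → ℕ → List ℕ → Composition
gaps m p []      = m ∸ p ∷ []
gaps m p (s ∷ S) = s ∸ p ∷ gaps m s S

-- The composition of m ≥ 1 encoding a subset of {1, …, m-1}.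
toComposition : ℕ → List ℕ → Composition
toComposition m = gaps m 0

pides : DyckPath m → Labelling m → Composition
pides {m} D c = toComposition m (descents (inverse (σ D c)))

------------------------------------------------------------------------
-- LLT polynomials

LLT[_] : DyckPath m → Series
LLT[ D ] = ∑ₓ (parkingFunctions D) λ c → (q^ dinv D c) • F (pides D c)

LLT : ℕ → Series
LLT zero      = 𝟙
LLT m@(suc _) = LLT[ zeroAreaPath m ]

{-# OPTIONS --safe #-}

-- At the monomial x^β with |β| = m, the polynomial LLT_m has the coefficient
-- (q;q)_m / ∏ᵢ (q;q)_{βᵢ}: it counts the permutations c whose entries decrease
-- on every block of β by coinversions, and removing the first entry of c (the
-- last element of its block) gives a recursion which the q-multinomial
-- coefficients satisfy by a telescoping sum.  As e_k has the coefficient 1 at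
-- the squarefree monomials of degree k, and
--   1/(q;q)_b - 1/(q;q)_{b-1} = q^b/(q;q)_b,
-- multiplying over the variables gives
--   ∑_{γδ = β, γ squarefree} (-1)^|γ| ∏ᵢ 1/(q;q)_{δᵢ} = q^|β| ∏ᵢ 1/(q;q)_{βᵢ},
-- and the theorem is (q;q)_{n-1} times the term γ = 1 of this sum minus the sum.

module Submission where

open import Algebra.Bundles using (CommutativeRing)
import Algebra.Solver.Ring as RingSolver
import Algebra.Solver.Ring.AlmostCommutativeRing as ACR
open import Algebra.Structures using (IsCommutativeRing)
open import Data.Bool.Base using (true; false; if_then_else_)
open import Data.Fin.Base as Fin
  using (Fin; zero; suc; toℕ; punchIn; punchOut; inject₁; fromℕ; opposite)
import Data.Fin.Properties as Fin
open import Data.Integer.Base as ℤ using (ℤ; +_; 0ℤ; 1ℤ; -1ℤ)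
import Data.Integer.Properties as ℤ
open import Data.Integer.Solver using (module +-*-Solver)
open import Data.List.Base as List
  using (List; []; _∷_; _++_; _∷ʳ_; map; foldr; filter; length; applyUpTo; upTo;
         allFin; tabulate; reverse; concatMap; downFrom; cartesianProduct;
         cartesianProductWith)
open import Data.List.Membership.Propositional using (_∈_)
open import Data.List.Membership.Propositional.Properties using (∈-upTo⁻)
import Data.List.Properties as List
open import Data.List.Relation.Unary.All as All using (All; []; _∷_)
import Data.List.Relation.Unary.All.Properties as All
open import Data.List.Relation.Unary.Any using (here; there)
open import Data.Maybe.Base as Maybe using (Maybe)
open import Data.Nat.Base as ℕ
  using (ℕ; zero; suc; _+_; _∸_; _<_; _≤_; s≤s; z≤n; s≤s⁻¹)
open import Data.Nat.ListAction using (sum)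
import Data.Nat.Properties as ℕ
open import Data.Product.Base using (_×_; _,_; proj₁; proj₂; ∃-syntax; Σ-syntax)
open import Data.Sum.Base using (inj₁; inj₂)
open import Data.Vec.Base as Vec
  using (Vec; []; _∷_; lookup; count; toList; replicate; removeAt)
import Data.Vec.Properties as Vec
open import Function.Base using (_∘_; id)
open import Relation.Binary.PropositionalEquality
  using (_≡_; _≢_; refl; sym; trans; cong; cong₂; subst; subst₂; setoid; module ≡-Reasoning)
import Relation.Binary.Reasoning.Setoid as SetoidReasoning
open import Relation.Nullary using (Dec; yes; no; ¬_; contradiction; does)
open import Relation.Nullary.Decidable
  using (_×-dec_; _→-dec_; ¬?; dec⇒maybe; dec-true; dec-false)
open import Relation.Unary using (Decidable)
open import Defs using
  (Monomial; HasMonomial; hasMonomial?; StrictlyIncreasing; strictlyIncreasing?; words;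
   factorisations; partialSums; FundamentalWord; fundamentalWord?; zeroAreaPath; area;
   columnsFrom; IsParkingFunction; isParkingFunction?; parkingFunctions; IsDinv; isDinv?;
   dinv; readingOrder; σ; position; inverse; descentsFrom; descents; gaps; pides)

-- Since (q;q)_{k-1} times the q-binomial coefficient is (q;q)_{n-1}/(q;q)_{n-k}, division by
-- (q;q)_{n-1} turns the theorem into (1 - q^n) L_n = ∑_{k≥1} (-1)^{k-1} e_k L_{n-k}, where L_m =
-- LLT_m/(q;q)_m. The L_m are the homogeneous parts of H(X) = ∏ᵢ 1/(xᵢ;q)_∞, and the identity is the
-- part of degree n of H(qX) = ∏ᵢ (1 - xᵢ) H(X). Both sides of this factor over the variables, which
-- is why one variable suffices. The main work is the passage from parking functions to this
-- product. Only one weakly increasing word has the content β, so each `F α` contributes 0 or 1 at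
-- x^β. Whether it contributes depends on descents, that is, on pairs of adjacent cars. This is
-- first turned into a condition on all pairs of cars in a block, because such a condition passes to
-- the remaining cars when the first one is removed.

private variable
  A B C P Q : Set
  ℓ m n : ℕ

-- The sums are manipulated over an abstract ring: over ℕ → ℤ itself, η would
-- unfold the operations during unification.
record ℤAlgebra : Set₁ where
  infix  4 _≐_
  infixl 6 _⊕_ _⊖_
  infixl 7 _⊗_
  infix  8 ⊖_
  field
    K       : Set
    _≐_     : K → K → Set
    _⊕_ _⊗_ : K → K → K
    ⊖_      : K → K
    const   : ℤ → K
    isCommutativeRing : IsCommutativeRing _≐_ _⊕_ _⊗_ ⊖_ (const 0ℤ) (const 1ℤ)
    const-+   : ∀ a b → const (a ℤ.+ b) ≐ const a ⊕ const b
    const-*   : ∀ a b → const (a ℤ.* b) ≐ const a ⊗ const b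
    const-neg : ∀ a → const (ℤ.- a) ≐ ⊖ const a

  _⊖_ : K → K → K
  f ⊖ g = f ⊕ ⊖ g

  commutativeRing : CommutativeRing _ _
  commutativeRing = record { isCommutativeRing = isCommutativeRing }

  module R = CommutativeRing commutativeRing
  module ≐-Reasoning = SetoidReasoning R.setoid

  ≐-refl : ∀ {f} → f ≐ f
  ≐-refl = R.refl

  const-homomorphism : ℤ.+-*-rawRing ACR.-Raw-AlmostCommutative⟶ ACR.fromCommutativeRing commutativeRing
  const-homomorphism = record
    { ⟦_⟧    = const
    ; +-homo = const-+
    ; *-homo = const-*
    ; -‿homo = const-neg
    ; 0-homo = ≐-refl
    ; 1-homo = ≐-refl
    }

  const-≟ : ∀ a b → Maybe (const a ≐ const b)
  const-≟ a b = Maybe.map (λ a≡b → R.reflexive (cong const a≡b)) (dec⇒maybe (a ℤ.≟ b))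

  open RingSolver ℤ.+-*-rawRing (ACR.fromCommutativeRing commutativeRing) const-homomorphism const-≟
    public using (solve; _:=_; _:+_; _:*_; _:-_; :-_; con)

  ∑ : ∀ {I : Set} → List I → (I → K) → K
  ∑ is f = foldr (λ i s → f i ⊕ s) (const 0ℤ) is

-- The q-identities rest on these laws alone. The inverses of the `qPoch k` are given as data, so
-- that q-multinomial coefficients can be written as products.
record QAlgebra : Set₁ where
  field algebra : ℤAlgebra
  open ℤAlgebra algebra public
  field
    q^_           : ℕ → K
    q^-0          : q^ 0 ≐ const 1ℤ
    q^-+          : ∀ a b → q^ (a ℕ.+ b) ≐ (q^ a) ⊗ (q^ b)
    qPoch         : ℕ → K
    qPoch-zero    : qPoch 0 ≐ const 1ℤ
    qPoch-suc     : ∀ k → qPoch (suc k) ≐ qPoch k ⊗ (const 1ℤ ⊖ q^ suc k)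
    qPoch⁻¹       : ℕ → K
    qPoch-inverse : ∀ k → qPoch k ⊗ qPoch⁻¹ k ≐ const 1ℤ

-- Finite sums and indicators

module Sums (𝒜 : ℤAlgebra) where
  open ℤAlgebra 𝒜

  ∑-cong : ∀ (is : List A) {f g : A → K} → (∀ i → f i ≐ g i) → ∑ is f ≐ ∑ is g
  ∑-cong []       f≐g = ≐-refl
  ∑-cong (i ∷ is) f≐g = R.+-cong (f≐g i) (∑-cong is f≐g)

  ∑-zero : ∀ (is : List A) {f : A → K} → (∀ i → f i ≐ const 0ℤ) → ∑ is f ≐ const 0ℤ
  ∑-zero []       f≐0 = ≐-refl
  ∑-zero (i ∷ is) f≐0 = R.trans (R.+-cong (f≐0 i) (∑-zero is f≐0)) (R.+-identityˡ _)

  ∑-⊕ : ∀ (is : List A) (f g : A → K) → ∑ is (λ i → f i ⊕ g i) ≐ ∑ is f ⊕ ∑ is g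
  ∑-⊕ []       f g = R.sym (R.+-identityˡ _)
  ∑-⊕ (i ∷ is) f g = R.trans (R.+-congˡ (∑-⊕ is f g))
    (solve 4 (λ a b s t → (a :+ b) :+ (s :+ t) := (a :+ s) :+ (b :+ t)) ≐-refl (f i) (g i) (∑ is f) (∑ is g))

  ∑-⊗ˡ : ∀ (is : List A) c (f : A → K) → c ⊗ ∑ is f ≐ ∑ is (λ i → c ⊗ f i)
  ∑-⊗ˡ []       c f = R.zeroʳ c
  ∑-⊗ˡ (i ∷ is) c f = R.trans (R.distribˡ c (f i) (∑ is f)) (R.+-congˡ (∑-⊗ˡ is c f))

  ∑-⊗ʳ : ∀ (is : List A) c (f : A → K) → ∑ is f ⊗ c ≐ ∑ is (λ i → f i ⊗ c)
  ∑-⊗ʳ []       c f = R.zeroˡ c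
  ∑-⊗ʳ (i ∷ is) c f = R.trans (R.distribʳ c (f i) (∑ is f)) (R.+-congˡ (∑-⊗ʳ is c f))

  ∑-swap : ∀ (is : List A) (js : List B) (f : A → B → K) →
           ∑ is (λ i → ∑ js (f i)) ≐ ∑ js (λ j → ∑ is (λ i → f i j))
  ∑-swap []       js f = R.sym (∑-zero js λ _ → ≐-refl)
  ∑-swap (i ∷ is) js f = R.trans (R.+-congˡ (∑-swap is js f)) (R.sym (∑-⊕ js _ _))

  ∑-++ : ∀ (is js : List A) (f : A → K) → ∑ (is ++ js) f ≐ ∑ is f ⊕ ∑ js f
  ∑-++ []       js f = R.sym (R.+-identityˡ _)
  ∑-++ (i ∷ is) js f = R.trans (R.+-congˡ (∑-++ is js f)) (R.sym (R.+-assoc (f i) _ _))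

  ∑-map : ∀ (h : A → B) (is : List A) (f : B → K) → ∑ (map h is) f ≐ ∑ is (f ∘ h)
  ∑-map h []       f = ≐-refl
  ∑-map h (i ∷ is) f = R.+-congˡ (∑-map h is f)

  ∑-cartesianProductWith : ∀ (h : A → B → C) is js (f : C → K) →
    ∑ (cartesianProductWith h is js) f ≐ ∑ is (λ i → ∑ js (λ j → f (h i j)))
  ∑-cartesianProductWith h []       js f = ≐-refl
  ∑-cartesianProductWith h (i ∷ is) js f = R.trans (∑-++ (map (h i) js) _ f)
    (R.+-cong (∑-map (h i) js f) (∑-cartesianProductWith h is js f))

  ∑-allFin-suc : ∀ n (f : Fin (suc n) → K) →
    ∑ (allFin (suc n)) f ≐ f zero ⊕ ∑ (allFin n) (f ∘ suc)
  ∑-allFin-suc n f = R.+-congˡ (R.trans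
    (R.reflexive (cong (λ is → ∑ is f) (sym (List.map-tabulate id suc)))) (∑-map suc (allFin n) f))

  ∑-upTo-suc : ∀ n (f : ℕ → K) → ∑ (upTo (suc n)) f ≐ f 0 ⊕ ∑ (upTo n) (f ∘ suc)
  ∑-upTo-suc n f = R.+-congˡ (R.trans
    (R.reflexive (cong (λ is → ∑ is f) (sym (List.map-upTo suc n)))) (∑-map suc (upTo n) f))

  𝟏 : Dec P → K
  𝟏 P? = if does P? then const 1ℤ else const 0ℤ

  𝟏-yes : (P? : Dec P) → P → 𝟏 P? ≐ const 1ℤ
  𝟏-yes (yes _) p = ≐-refl
  𝟏-yes (no ¬p) p = contradiction p ¬p

  𝟏-no : (P? : Dec P) → ¬ P → 𝟏 P? ≐ const 0ℤ
  𝟏-no (yes p) ¬p = contradiction p ¬p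
  𝟏-no (no _)  ¬p = ≐-refl

  𝟏-cong : (P? : Dec P) (Q? : Dec Q) → (P → Q) → (Q → P) → 𝟏 P? ≐ 𝟏 Q?
  𝟏-cong (yes p) Q? to from = R.sym (𝟏-yes Q? (to p))
  𝟏-cong (no ¬p) Q? to from = R.sym (𝟏-no Q? (¬p ∘ from))

  𝟏-× : (P? : Dec P) (Q? : Dec Q) → 𝟏 (P? ×-dec Q?) ≐ 𝟏 P? ⊗ 𝟏 Q?
  𝟏-× (yes _) Q? = R.sym (R.*-identityˡ _)
  𝟏-× (no _)  Q? = R.sym (R.zeroˡ _)

  -- This is how conditions such as injectivity of c or |β| = n become available as hypotheses
  -- inside a summand.
  𝟏-⊗-cong : ∀ (P? : Dec P) {f g} → (P → f ≐ g) → 𝟏 P? ⊗ f ≐ 𝟏 P? ⊗ g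
  𝟏-⊗-cong (yes p) f≐g = R.*-congˡ (f≐g p)
  𝟏-⊗-cong (no _)  f≐g = R.trans (R.zeroˡ _) (R.sym (R.zeroˡ _))

  𝟏-yes-⊗ : ∀ (P? : Dec P) f → P → 𝟏 P? ⊗ f ≐ f
  𝟏-yes-⊗ P? f p = R.trans (R.*-congʳ (𝟏-yes P? p)) (R.*-identityˡ f)

  𝟏-no-⊗ : ∀ (P? : Dec P) f → ¬ P → 𝟏 P? ⊗ f ≐ const 0ℤ
  𝟏-no-⊗ P? f ¬p = R.trans (R.*-congʳ (𝟏-no P? ¬p)) (R.zeroˡ f)

  ∑-filter : ∀ {P : A → Set} (P? : Decidable P) is (f : A → K) →
             ∑ (filter P? is) f ≐ ∑ is (λ i → 𝟏 (P? i) ⊗ f i)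
  ∑-filter P? []       f = ≐-refl
  ∑-filter P? (i ∷ is) f with P? i
  ... | yes p = R.+-cong (R.sym (R.*-identityˡ (f i))) (∑-filter P? is f)
  ... | no ¬p = R.trans (∑-filter P? is f)
                  (R.sym (R.trans (R.+-congʳ (R.zeroˡ (f i))) (R.+-identityˡ _)))

  const-suc : ∀ n → const (+ suc n) ≐ const 1ℤ ⊕ const (+ n)
  const-suc n = const-+ 1ℤ (+ n)

  const-length-filter : ∀ {P : A → Set} (P? : Decidable P) is →
                        const (+ length (filter P? is)) ≐ ∑ is (λ i → 𝟏 (P? i))
  const-length-filter P? []       = ≐-refl
  const-length-filter P? (i ∷ is) with P? i
  ... | yes p = R.trans (const-suc _) (R.+-congˡ (const-length-filter P? is))
  ... | no ¬p = R.trans (const-length-filter P? is) (R.sym (R.+-identityˡ _))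

  ∑-allFin-pick : ∀ {n} (a : Fin n) (f : Fin n → K) →
                  ∑ (allFin n) (λ i → 𝟏 (i Fin.≟ a) ⊗ f i) ≐ f a
  ∑-allFin-pick {suc n} zero f = begin
    ∑ (allFin (suc n)) (λ i → 𝟏 (i Fin.≟ zero) ⊗ f i)   ≈⟨ ∑-allFin-suc n _ ⟩
    const 1ℤ ⊗ f zero ⊕ ∑ (allFin n) (λ i → const 0ℤ ⊗ f (suc i))
      ≈⟨ R.+-cong (R.*-identityˡ _) (∑-zero (allFin n) λ i → R.zeroˡ _) ⟩
    f zero ⊕ const 0ℤ                                    ≈⟨ R.+-identityʳ _ ⟩
    f zero ∎
    where open ≐-Reasoning
  ∑-allFin-pick {suc n} (suc a) f = begin
    ∑ (allFin (suc n)) (λ i → 𝟏 (i Fin.≟ suc a) ⊗ f i)   ≈⟨ ∑-allFin-suc n _ ⟩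
    const 0ℤ ⊗ f zero ⊕ ∑ (allFin n) (λ i → 𝟏 (suc i Fin.≟ suc a) ⊗ f (suc i))
      ≈⟨ R.+-cong (R.zeroˡ _) (∑-cong (allFin n) λ i →
           R.*-congʳ (𝟏-cong (suc i Fin.≟ suc a) (i Fin.≟ a) Fin.suc-injective (cong suc))) ⟩
    const 0ℤ ⊕ ∑ (allFin n) (λ i → 𝟏 (i Fin.≟ a) ⊗ f (suc i))  ≈⟨ R.+-identityˡ _ ⟩
    ∑ (allFin n) (λ i → 𝟏 (i Fin.≟ a) ⊗ f (suc i))       ≈⟨ ∑-allFin-pick a (f ∘ suc) ⟩
    f (suc a) ∎
    where open ≐-Reasoning

  ∑-upTo-pick : ∀ {n s} → s < n → (f : ℕ → K) → ∑ (upTo n) (λ k → 𝟏 (s ℕ.≟ k) ⊗ f k) ≐ f s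
  ∑-upTo-pick {suc n} {zero} _ f = begin
    ∑ (upTo (suc n)) (λ k → 𝟏 (0 ℕ.≟ k) ⊗ f k)           ≈⟨ ∑-upTo-suc n _ ⟩
    const 1ℤ ⊗ f 0 ⊕ ∑ (upTo n) (λ k → const 0ℤ ⊗ f (suc k))
      ≈⟨ R.+-cong (R.*-identityˡ _) (∑-zero (upTo n) λ i → R.zeroˡ _) ⟩
    f 0 ⊕ const 0ℤ                                        ≈⟨ R.+-identityʳ _ ⟩
    f 0 ∎
    where open ≐-Reasoning
  ∑-upTo-pick {suc n} {suc s} (s≤s s<n) f = begin
    ∑ (upTo (suc n)) (λ k → 𝟏 (suc s ℕ.≟ k) ⊗ f k)       ≈⟨ ∑-upTo-suc n _ ⟩
    const 0ℤ ⊗ f 0 ⊕ ∑ (upTo n) (λ k → 𝟏 (s ℕ.≟ k) ⊗ f (suc k))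
      ≈⟨ R.+-congʳ (R.zeroˡ _) ⟩
    const 0ℤ ⊕ ∑ (upTo n) (λ k → 𝟏 (s ℕ.≟ k) ⊗ f (suc k)) ≈⟨ R.+-identityˡ _ ⟩
    ∑ (upTo n) (λ k → 𝟏 (s ℕ.≟ k) ⊗ f (suc k))           ≈⟨ ∑-upTo-pick s<n (f ∘ suc) ⟩
    f (suc s) ∎
    where open ≐-Reasoning

  ∑-words-suc : ∀ (as : List A) n (f : Vec A (suc n) → K) →
                ∑ (words as (suc n)) f ≐ ∑ as (λ a → ∑ (words as n) (λ w → f (a ∷ w)))
  ∑-words-suc as n f = ∑-cartesianProductWith _∷_ as (words as n) f

  ∑-words-pick : ∀ {ℓ n} (w₀ : Vec (Fin ℓ) n) (f : Vec (Fin ℓ) n → K) →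
                 ∑ (words (allFin ℓ) n) (λ w → 𝟏 (Vec.≡-dec Fin._≟_ w w₀) ⊗ f w) ≐ f w₀
  ∑-words-pick [] f = R.trans (R.+-identityʳ _) (R.*-identityˡ _)
  ∑-words-pick {ℓ} {suc n} (a₀ ∷ w₀) f = begin
    ∑ (words (allFin ℓ) (suc n)) (λ w → 𝟏 (w ≟ᵥ (a₀ ∷ w₀)) ⊗ f w)
      ≈⟨ ∑-words-suc (allFin ℓ) n _ ⟩
    ∑ (allFin ℓ) (λ a → ∑ (words (allFin ℓ) n) λ w → 𝟏 ((a ∷ w) ≟ᵥ (a₀ ∷ w₀)) ⊗ f (a ∷ w))
      ≈⟨ ∑-cong (allFin ℓ) (λ a → ∑-cong (words (allFin ℓ) n) λ w → split a w) ⟩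
    ∑ (allFin ℓ) (λ a → ∑ (words (allFin ℓ) n) λ w → 𝟏 (a Fin.≟ a₀) ⊗ (𝟏 (w ≟ᵥ w₀) ⊗ f (a ∷ w)))
      ≈⟨ ∑-cong (allFin ℓ) (λ a → R.sym (∑-⊗ˡ (words (allFin ℓ) n) _ _)) ⟩
    ∑ (allFin ℓ) (λ a → 𝟏 (a Fin.≟ a₀) ⊗ ∑ (words (allFin ℓ) n) λ w → 𝟏 (w ≟ᵥ w₀) ⊗ f (a ∷ w))
      ≈⟨ ∑-allFin-pick a₀ _ ⟩
    ∑ (words (allFin ℓ) n) (λ w → 𝟏 (w ≟ᵥ w₀) ⊗ f (a₀ ∷ w))
      ≈⟨ ∑-words-pick w₀ (f ∘ (a₀ ∷_)) ⟩
    f (a₀ ∷ w₀) ∎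
    where
    open ≐-Reasoning
    _≟ᵥ_ : ∀ {m} (u v : Vec (Fin ℓ) m) → Dec (u ≡ v)
    _≟ᵥ_ = Vec.≡-dec Fin._≟_
    split : ∀ a w → 𝟏 ((a ∷ w) ≟ᵥ (a₀ ∷ w₀)) ⊗ f (a ∷ w) ≐
                    𝟏 (a Fin.≟ a₀) ⊗ (𝟏 (w ≟ᵥ w₀) ⊗ f (a ∷ w))
    split a w = R.trans
      (R.*-congʳ (R.trans
        (𝟏-cong ((a ∷ w) ≟ᵥ (a₀ ∷ w₀)) ((a Fin.≟ a₀) ×-dec (w ≟ᵥ w₀))
          Vec.∷-injective (λ (p , r) → cong₂ _∷_ p r))
        (𝟏-× (a Fin.≟ a₀) (w ≟ᵥ w₀))))
      (R.*-assoc (𝟏 (a Fin.≟ a₀)) (𝟏 (w ≟ᵥ w₀)) (f (a ∷ w)))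

  -- `punchIn x` enumerates the elements other than x in increasing order. Sums over the letters
  -- that remain after the removal of x thus become sums over a smaller alphabet.
  ∑-punchIn : ∀ {m} x (f : Fin (suc m) → K) →
    ∑ (allFin (suc m)) (λ y → 𝟏 (¬? (x Fin.≟ y)) ⊗ f y) ≐ ∑ (allFin m) (f ∘ punchIn x)
  ∑-punchIn {m} zero f = R.trans (∑-allFin-suc m _)
    (R.trans (R.+-cong (R.zeroˡ _) (∑-cong (allFin m) λ i → R.*-identityˡ _)) (R.+-identityˡ _))
  ∑-punchIn {suc m} (suc x) f = begin
    ∑ (allFin (suc (suc m))) (λ y → 𝟏 (¬? (suc x Fin.≟ y)) ⊗ f y)
      ≈⟨ ∑-allFin-suc (suc m) _ ⟩
    const 1ℤ ⊗ f zero ⊕ ∑ (allFin (suc m)) (λ y → 𝟏 (¬? (suc x Fin.≟ suc y)) ⊗ f (suc y))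
      ≈⟨ R.+-cong (R.*-identityˡ _) (∑-cong (allFin (suc m)) λ y → R.*-congʳ
           (𝟏-cong (¬? (suc x Fin.≟ suc y)) (¬? (x Fin.≟ y)) (_∘ cong suc) (_∘ Fin.suc-injective))) ⟩
    f zero ⊕ ∑ (allFin (suc m)) (λ y → 𝟏 (¬? (x Fin.≟ y)) ⊗ f (suc y))
      ≈⟨ R.+-congˡ (∑-punchIn x (f ∘ suc)) ⟩
    f zero ⊕ ∑ (allFin m) (λ y → f (punchIn (suc x) (suc y)))
      ≈⟨ ∑-allFin-suc m (f ∘ punchIn (suc x)) ⟨
    ∑ (allFin (suc m)) (f ∘ punchIn (suc x)) ∎
    where open ≐-Reasoning

-- Words with prescribed content

module _ {P : A → Set} (P? : Decidable P) where

  count-yes : ∀ {x} (xs : Vec A n) → P x → count P? (x ∷ xs) ≡ suc (count P? xs)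
  count-yes {x = x} xs px with P? x
  ... | yes _  = refl
  ... | no ¬px = contradiction px ¬px

  count-no : ∀ {x} (xs : Vec A n) → ¬ P x → count P? (x ∷ xs) ≡ count P? xs
  count-no {x = x} xs ¬px with P? x
  ... | yes px = contradiction px ¬px
  ... | no _   = refl

  count-none : (xs : Vec A n) → (∀ i → ¬ P (lookup xs i)) → count P? xs ≡ 0
  count-none []       ¬P = refl
  count-none (x ∷ xs) ¬P = trans (count-no xs (¬P zero)) (count-none xs (¬P ∘ suc))

  count-∷-≥ : ∀ x (xs : Vec A n) → count P? xs ≤ count P? (x ∷ xs)
  count-∷-≥ x xs with P? x
  ... | yes _ = ℕ.n≤1+n _
  ... | no _  = ℕ.≤-refl

  count-≥1 : (xs : Vec A n) → ∀ i → P (lookup xs i) → 1 ≤ count P? xs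
  count-≥1 (x ∷ xs) zero    px = subst (1 ≤_) (sym (count-yes xs px)) (s≤s z≤n)
  count-≥1 (x ∷ xs) (suc i) px = ℕ.≤-trans (count-≥1 xs i px) (count-∷-≥ x xs)

  count-≥2 : (xs : Vec A n) → ∀ i j → i Fin.< j → P (lookup xs i) → P (lookup xs j) → 2 ≤ count P? xs
  count-≥2 (x ∷ xs) zero    (suc j) _         p r =
    subst (2 ≤_) (sym (count-yes xs p)) (s≤s (count-≥1 xs j r))
  count-≥2 (x ∷ xs) (suc i) (suc j) (s≤s i<j) p r =
    ℕ.≤-trans (count-≥2 xs i j i<j p r) (count-∷-≥ x xs)

count-cong : ∀ {P Q : A → Set} (P? : Decidable P) (Q? : Decidable Q) →
             (∀ x → P x → Q x) → (∀ x → Q x → P x) → (xs : Vec A n) → count P? xs ≡ count Q? xs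
count-cong P? Q? to from []       = refl
count-cong P? Q? to from (x ∷ xs) with P? x
... | yes px = trans (cong suc (count-cong P? Q? to from xs)) (sym (count-yes Q? xs (to x px)))
... | no ¬px = trans (count-cong P? Q? to from xs) (sym (count-no Q? xs (¬px ∘ from x)))

count-map : ∀ {P : B → Set} (P? : Decidable P) (f : A → B) (xs : Vec A n) →
            count P? (Vec.map f xs) ≡ count (P? ∘ f) xs
count-map P? f []       = refl
count-map P? f (x ∷ xs) with does (P? (f x))
... | true  = cong suc (count-map P? f xs)
... | false = count-map P? f xs

Monotone : Vec (Fin ℓ) n → Set
Monotone w = ∀ i j → i Fin.≤ j → lookup w i Fin.≤ lookup w j

monotone? : (w : Vec (Fin ℓ) n) → Dec (Monotone w)
monotone? w = Fin.all? λ i → Fin.all? λ j → (i Fin.≤? j) →-dec (lookup w i Fin.≤? lookup w j)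

monotone-tail : ∀ {a} {w : Vec (Fin ℓ) n} → Monotone (a ∷ w) → Monotone w
monotone-tail mono i j i≤j = mono (suc i) (suc j) (s≤s i≤j)

monotone-∷ : ∀ {a} {w : Vec (Fin ℓ) n} → (∀ i → a Fin.≤ lookup w i) → Monotone w → Monotone (a ∷ w)
monotone-∷ a≤w mono zero    zero    _         = ℕ.≤-refl
monotone-∷ a≤w mono zero    (suc j) _         = a≤w j
monotone-∷ a≤w mono (suc i) (suc j) (s≤s i≤j) = mono i j i≤j

-- Were a < b, every entry of the weakly increasing `b ∷ v` would exceed a, so that a would be
-- missing there although it occurs in `a ∷ u`.
monotone-head-≤ : ∀ a b (u : Vec (Fin ℓ) m) (v : Vec (Fin ℓ) n) → Monotone (b ∷ v) →
                  count (Fin._≟ a) (a ∷ u) ≡ count (Fin._≟ a) (b ∷ v) → b Fin.≤ a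
monotone-head-≤ a b u v mono eq = ℕ.≮⇒≥ λ a<b →
  ℕ.1+n≢0 (trans (sym (count-yes (Fin._≟ a) u refl)) (trans eq
    (count-none (Fin._≟ a) (b ∷ v) λ i vᵢ≡a →
      ℕ.<⇒≢ (ℕ.<-≤-trans a<b (mono zero i z≤n)) (cong toℕ (sym vᵢ≡a)))))

-- Each head bounds the other, so the heads agree and can be cancelled from the counts. The lengths
-- are allowed to differ, hence the equality of lists: `monotone-length` reads off from it that the
-- content determines the length.
monotone-unique : (u : Vec (Fin ℓ) m) (v : Vec (Fin ℓ) n) → Monotone u → Monotone v →
                  (∀ a → count (Fin._≟ a) u ≡ count (Fin._≟ a) v) → toList u ≡ toList v
monotone-unique []      []      _  _  _  = refl
monotone-unique []      (b ∷ v) _  _  eq =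
  contradiction (trans (eq b) (count-yes (Fin._≟ b) v refl)) λ ()
monotone-unique (a ∷ u) []      _  _  eq =
  contradiction (trans (sym (eq a)) (count-yes (Fin._≟ a) u refl)) λ ()
monotone-unique (a ∷ u) (b ∷ v) mu mv eq
  with refl ← Fin.toℕ-injective (ℕ.≤-antisym (monotone-head-≤ b a v u mu (sym (eq b)))
                                             (monotone-head-≤ a b u v mv (eq a)))
  = cong (a ∷_) (monotone-unique u v (monotone-tail mu) (monotone-tail mv) counts)
  where
  counts : ∀ x → count (Fin._≟ x) u ≡ count (Fin._≟ x) v
  counts x with a Fin.≟ x | eq x
  ... | yes _ | p = ℕ.suc-injective p
  ... | no _  | p = p

sorted : (β : Monomial) → Vec (Fin (length β)) (sum β)
sorted []      = []
sorted (b ∷ β) = replicate b zero Vec.++ Vec.map suc (sorted β)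

sorted-monotone : ∀ β → Monotone (sorted β)
sorted-monotone []      ()
sorted-monotone (b ∷ β) = prepend b
  where
  shift : Monotone (Vec.map suc (sorted β))
  shift i j i≤j = subst₂ Fin._≤_ (sym (Vec.lookup-map i suc (sorted β)))
    (sym (Vec.lookup-map j suc (sorted β))) (s≤s (sorted-monotone β i j i≤j))
  prepend : ∀ b → Monotone (replicate b zero Vec.++ Vec.map suc (sorted β))
  prepend zero    = shift
  prepend (suc b) = monotone-∷ (λ _ → z≤n) (prepend b)

sorted-hasMonomial : ∀ β → HasMonomial β (sorted β)
sorted-hasMonomial (b ∷ β) zero = zeros b
  where
  zeros : ∀ b → count (Fin._≟ zero) (replicate b zero Vec.++ Vec.map suc (sorted β)) ≡ b
  zeros zero    = trans (count-map (Fin._≟ zero) suc (sorted β)) (count-none _ (sorted β) λ _ ())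
  zeros (suc b) = cong suc (zeros b)
sorted-hasMonomial (b ∷ β) (suc v) = sucs b
  where
  sucs : ∀ b → count (Fin._≟ suc v) (replicate b zero Vec.++ Vec.map suc (sorted β)) ≡ List.lookup β v
  sucs zero    = trans (count-map (Fin._≟ suc v) suc (sorted β))
    (trans (count-cong _ (Fin._≟ v) (λ _ → Fin.suc-injective) (λ _ → cong suc) (sorted β))
           (sorted-hasMonomial β v))
  sucs (suc b) = sucs b

toList-sorted : ∀ β (w : Vec (Fin (length β)) n) → Monotone w → HasMonomial β w →
                toList w ≡ toList (sorted β)
toList-sorted β w mono has = monotone-unique w (sorted β) mono (sorted-monotone β)
  (λ a → trans (has a) (sym (sorted-hasMonomial β a)))

monotone-length : ∀ β (w : Vec (Fin (length β)) n) → Monotone w → HasMonomial β w → sum β ≡ n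
monotone-length β w mono has = trans (sym (Vec.length-toList (sorted β)))
  (trans (cong length (sym (toList-sorted β w mono has))) (Vec.length-toList w))

monotone⇒sorted : ∀ β (w : Vec (Fin (length β)) (sum β)) → Monotone w → HasMonomial β w →
                  w ≡ sorted β
monotone⇒sorted β w mono has = trans (sym (Vec.cast-is-id refl w))
  (Vec.toList-injective refl w (sorted β) (toList-sorted β w mono has))

strictlyIncreasing⇒monotone : {w : Vec (Fin ℓ) n} → StrictlyIncreasing w → Monotone w
strictlyIncreasing⇒monotone inc i j i≤j with ℕ.m≤n⇒m<n∨m≡n i≤j
... | inj₁ i<j = ℕ.<⇒≤ (inc i j i<j)
... | inj₂ i≡j with refl ← Fin.toℕ-injective i≡j = ℕ.≤-refl

strictlyIncreasing⇒count≤1 : (w : Vec (Fin ℓ) n) → StrictlyIncreasing w →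
                             ∀ v → count (Fin._≟ v) w ≤ 1
strictlyIncreasing⇒count≤1 []      inc v = z≤n
strictlyIncreasing⇒count≤1 (a ∷ w) inc v with a Fin.≟ v
... | yes refl = s≤s (ℕ.≤-reflexive (count-none (Fin._≟ v) w λ i wᵢ≡a →
                   ℕ.<⇒≢ (inc zero (suc i) (s≤s z≤n)) (cong toℕ (sym wᵢ≡a))))
... | no _     = strictlyIncreasing⇒count≤1 w (λ i j i<j → inc (suc i) (suc j) (s≤s i<j)) v

count≤1⇒strictlyIncreasing : (w : Vec (Fin ℓ) n) → Monotone w →
                             (∀ v → count (Fin._≟ v) w ≤ 1) → StrictlyIncreasing w
count≤1⇒strictlyIncreasing w mono count≤1 i j i<j = ℕ.≤∧≢⇒< (mono i j (ℕ.<⇒≤ i<j)) λ wᵢ≡wⱼ →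
  ℕ.<⇒≱ (count-≥2 (Fin._≟ lookup w j) w i j i<j (Fin.toℕ-injective wᵢ≡wⱼ) refl) (count≤1 (lookup w j))

-- Squarefree monomials and the coefficients of e_k

Squarefree : Monomial → Set
Squarefree = All (_≤ 1)

squarefree? : Decidable Squarefree
squarefree? = All.all? (ℕ._≤? 1)

squarefree-lookup : ∀ {β} → Squarefree β → ∀ v → List.lookup β v ≤ 1
squarefree-lookup (b ∷ _)  zero    = b
squarefree-lookup (_ ∷ bs) (suc v) = squarefree-lookup bs v

lookup-squarefree : ∀ β → (∀ v → List.lookup β v ≤ 1) → Squarefree β
lookup-squarefree []      h = []
lookup-squarefree (b ∷ β) h = h zero ∷ lookup-squarefree β (h ∘ suc)

module ContentSums (𝒜 : ℤAlgebra) where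
  open ℤAlgebra 𝒜
  open Sums 𝒜

  -- `sorted β` is the only weakly increasing word with content β, so at most one summand survives.
  -- The function f is defined on words of every length because `sorted β` has length `sum β`, which
  -- equals n only if the indicator on the right is 1.
  ∑-monotone : ∀ β n (f : ∀ {n} → Vec (Fin (length β)) n → K) →
    ∑ (words (allFin (length β)) n) (λ w → 𝟏 (hasMonomial? β w ×-dec monotone? w) ⊗ f w) ≐
    𝟏 (sum β ℕ.≟ n) ⊗ f (sorted β)
  ∑-monotone β n f = go n (sum β ℕ.≟ n)
    where
    open ≐-Reasoning
    go : ∀ n → Dec (sum β ≡ n) →
      ∑ (words (allFin (length β)) n) (λ w → 𝟏 (hasMonomial? β w ×-dec monotone? w) ⊗ f w) ≐
      𝟏 (sum β ℕ.≟ n) ⊗ f (sorted β)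
    go n (yes refl) = begin
      ∑ (words (allFin (length β)) n) (λ w → 𝟏 (hasMonomial? β w ×-dec monotone? w) ⊗ f w)
        ≈⟨ ∑-cong (words (allFin (length β)) n) (λ w → R.*-congʳ
             (𝟏-cong (hasMonomial? β w ×-dec monotone? w) (Vec.≡-dec Fin._≟_ w (sorted β))
               (λ (has , mono) → monotone⇒sorted β w mono has)
               (λ { refl → sorted-hasMonomial β , sorted-monotone β }))) ⟩
      ∑ (words (allFin (length β)) n) (λ w → 𝟏 (Vec.≡-dec Fin._≟_ w (sorted β)) ⊗ f w)
        ≈⟨ ∑-words-pick (sorted β) f ⟩
      f (sorted β)
        ≈⟨ 𝟏-yes-⊗ (sum β ℕ.≟ n) _ refl ⟨
      𝟏 (sum β ℕ.≟ n) ⊗ f (sorted β) ∎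
    go n (no ∑β≢n) = R.trans
      (∑-zero (words (allFin (length β)) n) λ w →
      𝟏-no-⊗ (hasMonomial? β w ×-dec monotone? w) (f w)
        (λ (has , mono) → ∑β≢n (monotone-length β w mono has)))
      (R.sym (𝟏-no-⊗ (sum β ℕ.≟ n) _ ∑β≢n))

  -- A word increases strictly exactly if it increases weakly and repeats no letter. For a word of
  -- content γ the second condition is that γ is squarefree, and `∑-monotone` counts the words
  -- satisfying the first. The left side is the coefficient of `e k`, with its integer mapped into
  -- the abstract ring.
  e-coefficient : ∀ k γ →
    const (+ length (filter (λ w → hasMonomial? γ w ×-dec strictlyIncreasing? w)
                            (words (allFin (length γ)) k))) ≐
    𝟏 (squarefree? γ) ⊗ 𝟏 (sum γ ℕ.≟ k)
  e-coefficient k γ = begin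
    const (+ length (filter (λ w → hasMonomial? γ w ×-dec strictlyIncreasing? w)
                            (words (allFin (length γ)) k)))
      ≈⟨ const-length-filter (λ w → hasMonomial? γ w ×-dec strictlyIncreasing? w) (words (allFin (length γ)) k) ⟩
    ∑ (words (allFin (length γ)) k) (λ w → 𝟏 (hasMonomial? γ w ×-dec strictlyIncreasing? w))
      ≈⟨ ∑-cong (words (allFin (length γ)) k) (λ w → R.trans
           (𝟏-cong (hasMonomial? γ w ×-dec strictlyIncreasing? w)
                   (squarefree? γ ×-dec (hasMonomial? γ w ×-dec monotone? w))
             (λ (has , inc) → lookup-squarefree γ
                  (λ v → subst (_≤ 1) (has v) (strictlyIncreasing⇒count≤1 w inc v))
                , has , strictlyIncreasing⇒monotone {w = w} inc)
             (λ (sf , has , mono) → has , count≤1⇒strictlyIncreasing w mono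
                  (λ v → subst (_≤ 1) (sym (has v)) (squarefree-lookup sf v))))
           (𝟏-× (squarefree? γ) (hasMonomial? γ w ×-dec monotone? w))) ⟩
    ∑ (words (allFin (length γ)) k) (λ w → 𝟏 (squarefree? γ) ⊗ 𝟏 (hasMonomial? γ w ×-dec monotone? w))
      ≈⟨ ∑-⊗ˡ (words (allFin (length γ)) k) _ _ ⟨
    𝟏 (squarefree? γ) ⊗ ∑ (words (allFin (length γ)) k) (λ w → 𝟏 (hasMonomial? γ w ×-dec monotone? w))
      ≈⟨ R.*-congˡ (∑-cong (words (allFin (length γ)) k) λ w → R.sym (R.*-identityʳ _)) ⟩
    𝟏 (squarefree? γ) ⊗ ∑ (words (allFin (length γ)) k)
      (λ w → 𝟏 (hasMonomial? γ w ×-dec monotone? w) ⊗ const 1ℤ)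
      ≈⟨ R.*-congˡ (∑-monotone γ k (λ _ → const 1ℤ)) ⟩
    𝟏 (squarefree? γ) ⊗ (𝟏 (sum γ ℕ.≟ k) ⊗ const 1ℤ)
      ≈⟨ R.*-congˡ (R.*-identityʳ _) ⟩
    𝟏 (squarefree? γ) ⊗ 𝟏 (sum γ ℕ.≟ k) ∎
    where open ≐-Reasoning

-- Permutations

Injective : Vec (Fin m) n → Set
Injective c = ∀ i j → lookup c i ≡ lookup c j → i ≡ j

injective? : (c : Vec (Fin m) n) → Dec (Injective c)
injective? c = Fin.all? λ i → Fin.all? λ j → (lookup c i Fin.≟ lookup c j) →-dec (i Fin.≟ j)

Avoids : Fin m → Vec (Fin m) n → Set
Avoids x c = ∀ i → x ≢ lookup c i

avoids? : (x : Fin m) (c : Vec (Fin m) n) → Dec (Avoids x c)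
avoids? x c = Fin.all? λ i → ¬? (x Fin.≟ lookup c i)

injective-∷⁻ : ∀ {x} {c : Vec (Fin m) n} → Injective (x ∷ c) → Avoids x c × Injective c
injective-∷⁻ inj = (λ i x≡cᵢ → contradiction (inj zero (suc i) x≡cᵢ) λ ())
                 , (λ i j cᵢ≡cⱼ → Fin.suc-injective (inj (suc i) (suc j) cᵢ≡cⱼ))

injective-∷⁺ : ∀ {x} {c : Vec (Fin m) n} → Avoids x c × Injective c → Injective (x ∷ c)
injective-∷⁺ (av , inj) zero    zero    _  = refl
injective-∷⁺ (av , inj) zero    (suc j) eq = contradiction eq (av j)
injective-∷⁺ (av , inj) (suc i) zero    eq = contradiction (sym eq) (av i)
injective-∷⁺ (av , inj) (suc i) (suc j) eq = cong suc (inj i j eq)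

module _ (x : Fin (suc m)) (c : Vec (Fin m) n) where

  injective-punchIn⁺ : Injective c → Injective (Vec.map (punchIn x) c)
  injective-punchIn⁺ inj i j eq = inj i j (Fin.punchIn-injective x _ _
    (trans (sym (Vec.lookup-map i (punchIn x) c)) (trans eq (Vec.lookup-map j (punchIn x) c))))

  injective-punchIn⁻ : Injective (Vec.map (punchIn x) c) → Injective c
  injective-punchIn⁻ inj i j eq = inj i j (trans (Vec.lookup-map i (punchIn x) c)
    (trans (cong (punchIn x) eq) (sym (Vec.lookup-map j (punchIn x) c))))

avoids⇒punchIn : ∀ (x : Fin (suc m)) (c : Vec (Fin (suc m)) n) → Avoids x c →
                 Σ[ d ∈ Vec (Fin m) n ] c ≡ Vec.map (punchIn x) d
avoids⇒punchIn x []      av = [] , refl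
avoids⇒punchIn x (y ∷ c) av with avoids⇒punchIn x c (av ∘ suc)
... | d , refl = punchOut (av zero) ∷ d , cong (_∷ _) (sym (Fin.punchIn-punchOut (av zero)))

-- A code in the manner of Lehmer: the first entry x, followed by the standardised rest, which
-- `punchIn x` relabels so as to skip x. Removal of the first entry becomes structural recursion.
data Permutation : ∀ {m} → Vec (Fin m) m → Set where
  []  : Permutation []
  _∷_ : ∀ {m} x {c : Vec (Fin m) m} → Permutation c → Permutation (x ∷ Vec.map (punchIn x) c)

injective⇒permutation : (c : Vec (Fin m) m) → Injective c → Permutation c
injective⇒permutation []      inj = []
injective⇒permutation (x ∷ c) inj with injective-∷⁻ {x = x} {c = c} inj
... | av , inj-c with avoids⇒punchIn x c av
... | d , refl = x ∷ injective⇒permutation d (injective-punchIn⁻ x d inj-c)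

permutation-surjective : {c : Vec (Fin m) m} → Permutation c → ∀ v → ∃[ i ] lookup c i ≡ v
permutation-surjective (_∷_ x {c} p) v with x Fin.≟ v
... | yes x≡v = zero , x≡v
... | no  x≢v with permutation-surjective p (punchOut x≢v)
... | i , cᵢ≡ = suc i , trans (Vec.lookup-map i (punchIn x) c)
                          (trans (cong (punchIn x) cᵢ≡) (Fin.punchIn-punchOut x≢v))

-- `punchIn x` fixes the values below x and raises the others by one. Hence a threshold t ≤ x is
-- respected in both directions, while a threshold t ≥ x moves to t + 1.
≤-punchIn : ∀ t (x : Fin (suc m)) → t ≤ toℕ x → ∀ y → t ≤ toℕ y → t ≤ toℕ (punchIn x y)
≤-punchIn zero    x       _         y       _         = z≤n
≤-punchIn (suc t) (suc x) (s≤s t≤x) (suc y) (s≤s t≤y) = s≤s (≤-punchIn t x t≤x y t≤y)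

≤-punchIn⁻ : ∀ t (x : Fin (suc m)) → t ≤ toℕ x → ∀ y → t ≤ toℕ (punchIn x y) → t ≤ toℕ y
≤-punchIn⁻ zero    x       _         y       _         = z≤n
≤-punchIn⁻ (suc t) (suc x) (s≤s t≤x) (suc y) (s≤s t≤y) = s≤s (≤-punchIn⁻ t x t≤x y t≤y)

suc≤-punchIn : ∀ t (x : Fin (suc m)) → toℕ x ≤ t → ∀ y → t ≤ toℕ y → suc t ≤ toℕ (punchIn x y)
suc≤-punchIn t       zero    _         y       t≤y       = s≤s t≤y
suc≤-punchIn (suc t) (suc x) (s≤s x≤t) (suc y) (s≤s t≤y) = s≤s (suc≤-punchIn t x x≤t y t≤y)

suc≤-punchIn⁻ : ∀ t (x : Fin (suc m)) → toℕ x ≤ t → ∀ y → suc t ≤ toℕ (punchIn x y) → t ≤ toℕ y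
suc≤-punchIn⁻ t       zero    _         y       (s≤s t≤y) = t≤y
suc≤-punchIn⁻ (suc t) (suc x) (s≤s x≤t) (suc y) (s≤s t≤y) = s≤s (suc≤-punchIn⁻ t x x≤t y t≤y)

-- Every value is taken once. In the induction the threshold stays the same for the standardised
-- tail if the first entry x reaches it, and drops by one otherwise.
count-permutation-≥ : {c : Vec (Fin m) m} → Permutation c → ∀ t →
                      count (λ y → t ℕ.≤? toℕ y) c ≡ m ∸ t
count-permutation-≥ []                  t = sym (ℕ.0∸n≡0 t)
count-permutation-≥ (_∷_ {m} x {c} p) t with t ℕ.≤? toℕ x
... | yes t≤x = begin
  count (λ y → t ℕ.≤? toℕ y) (x ∷ Vec.map (punchIn x) c)
    ≡⟨ count-yes (λ y → t ℕ.≤? toℕ y) (Vec.map (punchIn x) c) t≤x ⟩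
  suc (count (λ y → t ℕ.≤? toℕ y) (Vec.map (punchIn x) c))
    ≡⟨ cong suc (count-map _ (punchIn x) c) ⟩
  suc (count (λ y → t ℕ.≤? toℕ (punchIn x y)) c)
    ≡⟨ cong suc (count-cong _ _ (≤-punchIn⁻ t x t≤x) (≤-punchIn t x t≤x) c) ⟩
  suc (count (λ y → t ℕ.≤? toℕ y) c)
    ≡⟨ cong suc (count-permutation-≥ p t) ⟩
  suc (m ∸ t)
    -- The truncated subtraction is exact because t ≤ x ≤ m.
    ≡⟨ ℕ.+-∸-assoc 1 (ℕ.≤-trans t≤x (s≤s⁻¹ (Fin.toℕ<n x))) ⟨
  suc m ∸ t ∎
  where open ≡-Reasoning
count-permutation-≥ (_∷_ {m} x {c} p) zero    | no t≰x = contradiction z≤n t≰x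
count-permutation-≥ (_∷_ {m} x {c} p) (suc t) | no t≰x = begin
  count (λ y → suc t ℕ.≤? toℕ y) (x ∷ Vec.map (punchIn x) c)
    ≡⟨ count-no (λ y → suc t ℕ.≤? toℕ y) (Vec.map (punchIn x) c) t≰x ⟩
  count (λ y → suc t ℕ.≤? toℕ y) (Vec.map (punchIn x) c)
    ≡⟨ count-map _ (punchIn x) c ⟩
  count (λ y → suc t ℕ.≤? toℕ (punchIn x y)) c
    ≡⟨ count-cong _ _ (suc≤-punchIn⁻ t x x≤t) (suc≤-punchIn t x x≤t) c ⟩
  count (λ y → t ℕ.≤? toℕ y) c
    ≡⟨ count-permutation-≥ p t ⟩
  m ∸ t ∎
  where
  open ≡-Reasoning
  x≤t = s≤s⁻¹ (ℕ.≰⇒> t≰x)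

-- Coinversions: pairs of places whose entries stand in increasing order. On a path of zero area
-- they are the dinv pairs.
coinv : Vec (Fin m) n → ℕ
coinv []      = 0
coinv (x ∷ c) = count (x Fin.<?_) c + coinv c

coinv-punchIn : ∀ (x : Fin (suc m)) (c : Vec (Fin m) n) → coinv (Vec.map (punchIn x) c) ≡ coinv c
coinv-punchIn x []      = refl
coinv-punchIn x (y ∷ c) = cong₂ _+_
  (trans (count-map _ (punchIn x) c) (count-cong _ _
    (λ z lt → ℕ.≰⇒> λ z≤y → ℕ.<⇒≱ lt (Fin.punchIn-mono-≤ x z y z≤y))
    (λ z lt → ℕ.≰⇒> λ z≤y → ℕ.<⇒≱ lt (Fin.punchIn-cancel-≤ x z y z≤y)) c))
  (coinv-punchIn x c)

-- All m - x values above x come later, and standardising the rest keeps its relative order. This is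
-- the source of the weight q^(m - x) in the recursion.
coinv-∷ : ∀ (x : Fin (suc m)) {c : Vec (Fin m) m} → Permutation c →
          coinv (x ∷ Vec.map (punchIn x) c) ≡ (m ∸ toℕ x) + coinv c
coinv-∷ x {c} p = cong₂ _+_
  (trans (count-map _ (punchIn x) c) (trans
    (count-cong _ _ (suc≤-punchIn⁻ (toℕ x) x ℕ.≤-refl) (suc≤-punchIn (toℕ x) x ℕ.≤-refl) c)
    (count-permutation-≥ p (toℕ x))))
  (coinv-punchIn x c)

-- Good c w: the entries of c carrying the same letter of w decrease.
Good : Vec (Fin m) n → Vec (Fin ℓ) m → Set
Good c w = ∀ s t → s Fin.< t → lookup c s Fin.< lookup c t →
           lookup w (lookup c s) Fin.< lookup w (lookup c t)

good? : (c : Vec (Fin m) n) (w : Vec (Fin ℓ) m) → Dec (Good c w)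
good? c w = Fin.all? λ s → Fin.all? λ t → (s Fin.<? t) →-dec
  ((lookup c s Fin.<? lookup c t) →-dec (lookup w (lookup c s) Fin.<? lookup w (lookup c t)))

-- For a weakly increasing w the places carrying one letter form an interval, and this condition
-- singles out its right end.
LastOfBlock : Fin m → Vec (Fin ℓ) m → Set
LastOfBlock x w = ∀ y → x Fin.< y → lookup w x Fin.< lookup w y

lastOfBlock? : (x : Fin m) (w : Vec (Fin ℓ) m) → Dec (LastOfBlock x w)
lastOfBlock? x w = Fin.all? λ y → (x Fin.<? y) →-dec (lookup w x Fin.<? lookup w y)

lookup-removeAt : ∀ (w : Vec A (suc m)) x i → lookup (removeAt w x) i ≡ lookup w (punchIn x i)
lookup-removeAt (a ∷ w)       zero    i       = refl
lookup-removeAt (a ∷ w@(_ ∷ _)) (suc x) zero    = refl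
lookup-removeAt (a ∷ w@(_ ∷ _)) (suc x) (suc i) = lookup-removeAt w x i

monotone-removeAt : ∀ (w : Vec (Fin ℓ) (suc m)) x → Monotone w → Monotone (removeAt w x)
monotone-removeAt w x mono i j i≤j =
  subst₂ Fin._≤_ (sym (lookup-removeAt w x i)) (sym (lookup-removeAt w x j))
    (mono _ _ (Fin.punchIn-mono-≤ x i j i≤j))

module _ (x : Fin (suc m)) {c : Vec (Fin m) m} (p : Permutation c) (w : Vec (Fin ℓ) (suc m)) where

  private
    c↑ = Vec.map (punchIn x) c

    lookup-c↑ : ∀ i → lookup c↑ i ≡ punchIn x (lookup c i)
    lookup-c↑ i = Vec.lookup-map i (punchIn x) c

  -- By surjectivity every y > x stands somewhere after x, so the pairs that involve the first place
  -- say precisely that x is last in its block. The other pairs concern c, whose standardisation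
  -- matches the deletion of place x from w.
  good-∷⁻ : Good (x ∷ c↑) w → LastOfBlock x w × Good c (removeAt w x)
  good-∷⁻ good = last , good′
    where
    last : LastOfBlock x w
    last y x<y with permutation-surjective (x ∷ p) y
    ... | zero  , refl = contradiction x<y (ℕ.<-irrefl refl)
    ... | suc i , refl = good zero (suc i) (s≤s z≤n) x<y
    good′ : Good c (removeAt w x)
    good′ s t s<t lt = subst₂ Fin._<_
      (trans (cong (lookup w) (lookup-c↑ s)) (sym (lookup-removeAt w x _)))
      (trans (cong (lookup w) (lookup-c↑ t)) (sym (lookup-removeAt w x _)))
      (good (suc s) (suc t) (s≤s s<t)
        (subst₂ Fin._<_ (sym (lookup-c↑ s)) (sym (lookup-c↑ t))
          (ℕ.≰⇒> λ ge → ℕ.<⇒≱ lt (Fin.punchIn-cancel-≤ x _ _ ge))))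

  good-∷⁺ : LastOfBlock x w × Good c (removeAt w x) → Good (x ∷ c↑) w
  good-∷⁺ (last , good) zero    (suc t) _         lt = last _ lt
  good-∷⁺ (last , good) (suc s) (suc t) (s≤s s<t) lt = subst₂ Fin._<_
    (sym (trans (cong (lookup w) (lookup-c↑ s)) (sym (lookup-removeAt w x _))))
    (sym (trans (cong (lookup w) (lookup-c↑ t)) (sym (lookup-removeAt w x _))))
    (good s t s<t (ℕ.≰⇒> λ ge → ℕ.<⇒≱
      (subst₂ Fin._<_ (lookup-c↑ s) (lookup-c↑ t) lt) (Fin.punchIn-mono-≤ x _ _ ge)))

-- Parking functions on (NE)ᵐ

area-zeroAreaPath : ∀ m i → lookup (area (zeroAreaPath m)) i ≡ 0
area-zeroAreaPath (suc m) zero    = refl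
area-zeroAreaPath (suc m) (suc i) = area-zeroAreaPath m i

columns-zeroAreaPath : ∀ x m i → lookup (columnsFrom x (zeroAreaPath m)) i ≡ x + toℕ i
columns-zeroAreaPath x (suc m) zero    = sym (ℕ.+-identityʳ x)
columns-zeroAreaPath x (suc m) (suc i) =
  trans (columns-zeroAreaPath (suc x) m i) (sym (ℕ.+-suc x (toℕ i)))

-- No column of (NE)ᵐ contains two North steps, so there is nothing to check up the columns.
injective⇒parking : (c : Vec (Fin m) m) → Injective c → IsParkingFunction (zeroAreaPath m) c
injective⇒parking {m} c inj = inj , λ i j i<j eq → contradiction
  (trans (sym (columns-zeroAreaPath 0 m i)) (trans eq (columns-zeroAreaPath 0 m j))) (ℕ.<⇒≢ i<j)

concatMap-downFrom : (f : ℕ → List A) → (∀ a → f (suc a) ≡ []) →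
                     ∀ m → concatMap f (downFrom (suc m)) ≡ f 0
concatMap-downFrom f f≡[] zero    = List.++-identityʳ (f 0)
concatMap-downFrom f f≡[] (suc m) =
  trans (cong (_++ concatMap f (downFrom (suc m))) (f≡[] m)) (concatMap-downFrom f f≡[] m)

-- All rows lie on the diagonal 0; the higher diagonals contribute empty lists.
readingOrder-zeroAreaPath : ∀ m → readingOrder (zeroAreaPath (suc m)) ≡ reverse (allFin (suc m))
readingOrder-zeroAreaPath m = trans
  (concatMap-downFrom (λ a → filter (onDiagonal? a) rows)
    (λ a → List.filter-none (onDiagonal? (suc a)) (All.universal
      (λ i aᵢ≡1+a → ℕ.0≢1+n (trans (sym (area-zeroAreaPath (suc m) i)) aᵢ≡1+a)) rows)) m)
  (List.filter-all (onDiagonal? 0) (All.universal (area-zeroAreaPath (suc m)) rows))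
  where
  rows = reverse (allFin (suc m))
  onDiagonal? : ∀ a i → Dec (lookup (area (zeroAreaPath (suc m))) i ≡ a)
  onDiagonal? a i = lookup (area (zeroAreaPath (suc m))) i ℕ.≟ a

tabulate-∷ʳ : (g : Fin (suc n) → A) → tabulate g ≡ tabulate (g ∘ inject₁) ∷ʳ g (fromℕ n)
tabulate-∷ʳ {n = zero}  g = refl
tabulate-∷ʳ {n = suc n} g = cong (g zero ∷_) (tabulate-∷ʳ (g ∘ suc))

opposite-inject₁ : (i : Fin n) → opposite (inject₁ i) ≡ suc (opposite i)
opposite-inject₁ zero    = refl
opposite-inject₁ (suc i) = cong inject₁ (opposite-inject₁ i)

opposite-fromℕ : ∀ n → opposite (fromℕ n) ≡ zero
opposite-fromℕ zero    = refl
opposite-fromℕ (suc n) = cong inject₁ (opposite-fromℕ n)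

reverse-tabulate : (f : Fin n → A) → reverse (tabulate f) ≡ tabulate (f ∘ opposite)
reverse-tabulate {n = zero}  f = refl
reverse-tabulate {n = suc n} f = begin
  reverse (f zero ∷ tabulate (f ∘ suc))        ≡⟨ List.unfold-reverse (f zero) (tabulate (f ∘ suc)) ⟩
  reverse (tabulate (f ∘ suc)) ∷ʳ f zero       ≡⟨ cong (_∷ʳ f zero) (reverse-tabulate (f ∘ suc)) ⟩
  tabulate (f ∘ suc ∘ opposite) ∷ʳ f zero
    ≡⟨ cong₂ _∷ʳ_ (List.tabulate-cong (λ i → cong f (opposite-inject₁ i))) (cong f (opposite-fromℕ n)) ⟨
  tabulate (f ∘ opposite ∘ inject₁) ∷ʳ f (opposite (fromℕ n))
    ≡⟨ tabulate-∷ʳ (f ∘ opposite) ⟨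
  tabulate (f ∘ opposite) ∎
  where open ≡-Reasoning

σ-zeroAreaPath : (c : Vec (Fin (suc m)) (suc m)) →
                 σ (zeroAreaPath (suc m)) c ≡ tabulate (lookup c ∘ opposite)
σ-zeroAreaPath {m} c = begin
  map (lookup c) (readingOrder (zeroAreaPath (suc m)))
    ≡⟨ cong (map (lookup c)) (trans (readingOrder-zeroAreaPath m) (reverse-tabulate id)) ⟩
  map (lookup c) (tabulate opposite)
    ≡⟨ List.map-tabulate opposite (lookup c) ⟩
  tabulate (lookup c ∘ opposite) ∎
  where open ≡-Reasoning

position-tabulate : (g : Fin n → Fin m) → (∀ i j → g i ≡ g j → i ≡ j) →
                    ∀ i → position (g i) (tabulate g) ≡ toℕ i
position-tabulate g inj zero with g zero Fin.≟ g zero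
... | yes _ = refl
... | no ¬p = contradiction refl ¬p
position-tabulate g inj (suc i) with g zero Fin.≟ g (suc i)
... | yes p = contradiction (inj zero (suc i) p) λ ()
... | no _  = cong suc (position-tabulate (g ∘ suc) (λ i j p → Fin.suc-injective (inj _ _ p)) i)

-- Descent sets and their compositions

descentsFrom-≥ : ∀ s L → All (s ≤_) (descentsFrom s L)
descentsFrom-≥ s []          = []
descentsFrom-≥ s (x ∷ [])    = []
descentsFrom-≥ s (x ∷ y ∷ L) with does (y ℕ.<? x) | descentsFrom-≥ (suc s) (y ∷ L)
... | true  | ge = ℕ.≤-refl ∷ All.map ℕ.<⇒≤ ge
... | false | ge = All.map ℕ.<⇒≤ ge

descentsFrom-yes : ∀ s {x y} L → y < x →
                   descentsFrom s (x ∷ y ∷ L) ≡ s ∷ descentsFrom (suc s) (y ∷ L)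
descentsFrom-yes s {x} {y} L y<x rewrite dec-true (y ℕ.<? x) y<x = refl

descentsFrom-no : ∀ s {x y} L → ¬ y < x →
                  descentsFrom s (x ∷ y ∷ L) ≡ descentsFrom (suc s) (y ∷ L)
descentsFrom-no s {x} {y} L y≮x rewrite dec-false (y ℕ.<? x) y≮x = refl

-- The label `s + toℕ j` belongs to the comparison of the entries j and j + 1. Labels grow along the
-- list, so different comparisons cannot be confused.
∈-descentsFrom⁻ : ∀ s (f : Fin (suc m) → ℕ) j → s + toℕ j ∈ descentsFrom s (tabulate f) →
                  f (suc j) < f (inject₁ j)
∈-descentsFrom⁻ {suc m} s f j s∈ with f (suc zero) ℕ.<? f zero
∈-descentsFrom⁻ {suc m} s f zero    s∈ | yes lt = lt
∈-descentsFrom⁻ {suc m} s f (suc j) s∈ | yes lt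
  with subst (s + suc (toℕ j) ∈_) (descentsFrom-yes s (tabulate {n = m} λ i → f (suc (suc i))) lt) s∈
... | here eq    = contradiction eq (ℕ.m+1+n≢m s)
... | there s∈′  = ∈-descentsFrom⁻ (suc s) (f ∘ suc) j (subst (_∈ descentsFrom (suc s) (tabulate (f ∘ suc))) (ℕ.+-suc s (toℕ j)) s∈′)
∈-descentsFrom⁻ {suc m} s f zero    s∈ | no ≮ = contradiction
  (All.lookup (descentsFrom-≥ (suc s) (tabulate (f ∘ suc)))
    (subst (s + 0 ∈_) (descentsFrom-no s (tabulate {n = m} λ i → f (suc (suc i))) ≮) s∈))
  (ℕ.<⇒≱ (s≤s (ℕ.≤-reflexive (ℕ.+-identityʳ s))))
∈-descentsFrom⁻ {suc m} s f (suc j) s∈ | no ≮ = ∈-descentsFrom⁻ (suc s) (f ∘ suc) j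
  (subst (_∈ descentsFrom (suc s) (tabulate (f ∘ suc))) (ℕ.+-suc s (toℕ j)) (subst (s + suc (toℕ j) ∈_) (descentsFrom-no s (tabulate {n = m} λ i → f (suc (suc i))) ≮) s∈))

∈-descentsFrom⁺ : ∀ s (f : Fin (suc m) → ℕ) j → f (suc j) < f (inject₁ j) →
                  s + toℕ j ∈ descentsFrom s (tabulate f)
∈-descentsFrom⁺ {suc m} s f zero    lt =
  subst (s + 0 ∈_) (sym (descentsFrom-yes s (tabulate {n = m} λ i → f (suc (suc i))) lt)) (here (ℕ.+-identityʳ s))
∈-descentsFrom⁺ {suc m} s f (suc j) lt
  with does (f (suc zero) ℕ.<? f zero)
     | subst (_∈ descentsFrom (suc s) (tabulate (f ∘ suc))) (sym (ℕ.+-suc s (toℕ j)))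
         (∈-descentsFrom⁺ (suc s) (f ∘ suc) j lt)
... | true  | s∈ = there s∈
... | false | s∈ = s∈

partialSums-gaps-∷ : ∀ a m s S →
  partialSums (a ∷ gaps m s S) ≡ a ∷ map (_+_ a) (partialSums (gaps m s S))
partialSums-gaps-∷ a m s []      = refl
partialSums-gaps-∷ a m s (_ ∷ _) = refl

-- Sums of successive differences telescope: (s - p) + (d - s) = d - p. Here p is the last descent
-- recorded and s the label of the next comparison; since p ≤ s and all later descents d exceed s,
-- the truncated subtractions are exact.
partialSums-gaps : ∀ m p s L → p ≤ s →
  partialSums (gaps m p (descentsFrom s L)) ≡ map (_∸ p) (descentsFrom s L)
partialSums-gaps m p s []          p≤s = refl
partialSums-gaps m p s (x ∷ [])    p≤s = refl
partialSums-gaps m p s (x ∷ y ∷ L) p≤s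
  with does (y ℕ.<? x)
     | partialSums-gaps m p (suc s) (y ∷ L) (ℕ.m≤n⇒m≤1+n p≤s)
     | partialSums-gaps m s (suc s) (y ∷ L) (ℕ.n≤1+n s)
... | false | ih | _  = ih
... | true  | _  | ih = begin
  partialSums (s ∸ p ∷ gaps m s D)                   ≡⟨ partialSums-gaps-∷ (s ∸ p) m s D ⟩
  s ∸ p ∷ map (_+_ (s ∸ p)) (partialSums (gaps m s D))
    ≡⟨ cong (λ S → s ∸ p ∷ map (_+_ (s ∸ p)) S) ih ⟩
  s ∸ p ∷ map (_+_ (s ∸ p)) (map (_∸ s) D)              ≡⟨ cong (s ∸ p ∷_) (List.map-∘ D) ⟨
  s ∸ p ∷ map (λ d → s ∸ p + (d ∸ s)) D
    ≡⟨ cong (s ∸ p ∷_) (List.map-cong-local (All.map shift (descentsFrom-≥ (suc s) (y ∷ L)))) ⟩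
  s ∸ p ∷ map (_∸ p) D ∎
  where
  open ≡-Reasoning
  D = descentsFrom (suc s) (y ∷ L)
  shift : ∀ {d} → s < d → s ∸ p + (d ∸ s) ≡ d ∸ p
  shift {d} s<d = trans (ℕ.+-comm (s ∸ p) (d ∸ s)) (trans (sym (ℕ.+-∸-assoc (d ∸ s) p≤s))
    (cong (_∸ p) (ℕ.m∸n+n≡m (ℕ.<⇒≤ s<d))))

+-suc-≤ : ∀ s {k m} → s + suc k ≤ m → suc s + k ≤ m
+-suc-≤ s {k} {m} = subst (_≤ m) (ℕ.+-suc s k)

-- The same telescoping, up to the final gap m - s; the bound on `length L` keeps every descent at
-- most m. At p = 0 it yields the length of the words that `F` sums over.
sum-gaps : ∀ m p s L → p ≤ s → s + length L ≤ suc m → sum (gaps m p (descentsFrom s L)) ≡ m ∸ p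
sum-gaps m p s []          p≤s _ = ℕ.+-identityʳ _
sum-gaps m p s (x ∷ [])    p≤s _ = ℕ.+-identityʳ _
sum-gaps m p s (x ∷ y ∷ L) p≤s s+L≤m
  with does (y ℕ.<? x)
     | sum-gaps m p (suc s) (y ∷ L) (ℕ.m≤n⇒m≤1+n p≤s) (+-suc-≤ s s+L≤m)
     | sum-gaps m s (suc s) (y ∷ L) (ℕ.n≤1+n s) (+-suc-≤ s s+L≤m)
... | false | ih | _  = ih
... | true  | _  | ih = begin
  (s ∸ p) + sum (gaps m s (descentsFrom (suc s) (y ∷ L)))
    ≡⟨ cong (_+_ (s ∸ p)) ih ⟩
  (s ∸ p) + (m ∸ s)    ≡⟨ ℕ.+-comm (s ∸ p) (m ∸ s) ⟩
  (m ∸ s) + (s ∸ p)    ≡⟨ ℕ.+-∸-assoc (m ∸ s) p≤s ⟨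
  (m ∸ s) + s ∸ p      ≡⟨ cong (_∸ p) (ℕ.m∸n+n≡m (ℕ.≤-trans (ℕ.m≤m+n s _) (s≤s⁻¹ (+-suc-≤ s s+L≤m)))) ⟩
  m ∸ p ∎
  where open ≡-Reasoning

descentSet : Vec (Fin m) m → List ℕ
descentSet {m} c = descents (inverse (σ (zeroAreaPath m) c))

partialSums-pides : (c : Vec (Fin m) m) → partialSums (pides (zeroAreaPath m) c) ≡ descentSet c
partialSums-pides {m} c = trans (partialSums-gaps m 0 1 (inverse (σ (zeroAreaPath m) c)) z≤n) (List.map-id _)

sum-pides : (c : Vec (Fin m) m) → sum (pides (zeroAreaPath m) c) ≡ m
sum-pides {m} c = sum-gaps m 0 1 (inverse (σ (zeroAreaPath m) c)) z≤n (s≤s (ℕ.≤-reflexive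
  (trans (List.length-map _ (allFin m)) (List.length-tabulate id))))

consecutive-≤ : (W : Fin (suc m) → ℕ) → (∀ k → W (inject₁ k) ≤ W (suc k)) →
                ∀ i j → i Fin.≤ j → W i ≤ W j
consecutive-≤         W step zero    zero    _         = ℕ.≤-refl
consecutive-≤ {suc m} W step zero    (suc j) _         =
  ℕ.≤-trans (step zero) (consecutive-≤ (W ∘ suc) (step ∘ suc) zero j z≤n)
consecutive-≤ {suc m} W step (suc i) (suc j) (s≤s i≤j) = consecutive-≤ (W ∘ suc) (step ∘ suc) i j i≤j

-- If p is smaller at j than at i, it drops at some step in between, and there W increases strictly.
-- Either the first step is a drop, or the value of p after it is still above p j and the drop comes
-- later.
consecutive-< : (W p : Fin (suc m) → ℕ) → (∀ k → W (inject₁ k) ≤ W (suc k)) →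
                (∀ k → p (suc k) < p (inject₁ k) → W (inject₁ k) < W (suc k)) →
                ∀ i j → i Fin.< j → p j < p i → W i < W j
consecutive-< {suc m} W p step strict zero    (suc j) _ lt with p (suc zero) ℕ.<? p zero
... | yes p₁<p₀ = ℕ.<-≤-trans (strict zero p₁<p₀) (consecutive-≤ (W ∘ suc) (step ∘ suc) zero j z≤n)
consecutive-< {suc m} W p step strict zero (suc zero)    _ lt | no p₁≮p₀ = contradiction lt p₁≮p₀
consecutive-< {suc m} W p step strict zero (suc (suc j)) _ lt | no p₁≮p₀ =
  ℕ.≤-<-trans (step zero) (consecutive-< (W ∘ suc) (p ∘ suc) (step ∘ suc) (strict ∘ suc) zero (suc j)
    (s≤s z≤n) (ℕ.<-≤-trans lt (ℕ.≮⇒≥ p₁≮p₀)))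
consecutive-< {suc m} W p step strict (suc i) (suc j) (s≤s i<j) lt =
  consecutive-< (W ∘ suc) (p ∘ suc) (step ∘ suc) (strict ∘ suc) i j i<j lt

module _ (c : Vec (Fin (suc m)) (suc m)) (inj : Injective c) (w : Vec (Fin ℓ) (suc m)) where

  private
    pos : Fin (suc m) → ℕ
    pos v = position v (σ (zeroAreaPath (suc m)) c)

    -- σ reads the cars of c backwards, so a car further to the right in c has a smaller position in
    -- σ.
    pos-lookup : ∀ s → pos (lookup c s) ≡ suc m ∸ suc (toℕ s)
    pos-lookup s = begin
      position (lookup c s) (σ (zeroAreaPath (suc m)) c)
        ≡⟨ cong (position (lookup c s)) (σ-zeroAreaPath c) ⟩
      position (lookup c s) (tabulate (lookup c ∘ opposite))
        ≡⟨ cong (λ i → position (lookup c i) (tabulate (lookup c ∘ opposite))) (Fin.opposite-involutive s) ⟨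
      position (lookup c (opposite (opposite s))) (tabulate (lookup c ∘ opposite))
        ≡⟨ position-tabulate (lookup c ∘ opposite) opp-inj (opposite s) ⟩
      toℕ (opposite s)
        ≡⟨ Fin.opposite-prop s ⟩
      suc m ∸ suc (toℕ s) ∎
      where
      open ≡-Reasoning
      opp-inj : ∀ i j → lookup c (opposite i) ≡ lookup c (opposite j) → i ≡ j
      opp-inj i j eq = trans (sym (Fin.opposite-involutive i))
        (trans (cong opposite (inj _ _ eq)) (Fin.opposite-involutive j))

    pos-anti : ∀ s t → s Fin.< t → pos (lookup c t) < pos (lookup c s)
    pos-anti s t s<t = subst₂ _<_ (sym (pos-lookup t)) (sym (pos-lookup s))
      (ℕ.∸-monoʳ-< (s≤s s<t) (Fin.toℕ<n t))

    pos-anti⁻ : ∀ s t → pos (lookup c t) < pos (lookup c s) → s Fin.< t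
    pos-anti⁻ s t lt = ℕ.≰⇒> λ t≤s → ℕ.<⇒≱ (subst₂ _<_ (pos-lookup t) (pos-lookup s) lt)
      (ℕ.∸-monoʳ-≤ (suc m) (s≤s t≤s))

    inverse-σ : inverse (σ (zeroAreaPath (suc m)) c) ≡ tabulate pos
    inverse-σ = List.map-tabulate id pos

  -- A descent of the inverse of σ between the values k and k + 1 means that k + 1 is read first, so
  -- that k precedes k + 1 in c. `FundamentalWord` asks for a strict increase of w at such adjacent
  -- values, and `consecutive-<` extends it to all values u < v with u before v in c.
  fundamental⇒good : FundamentalWord (descentSet c) w → Monotone w × Good c w
  fundamental⇒good fund =
      consecutive-≤ (toℕ ∘ lookup w) step
    , λ s t s<t lt → consecutive-< (toℕ ∘ lookup w) pos step strict _ _ lt (pos-anti s t s<t)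
    where
    fund′ : ∀ (k : Fin m) → _
    fund′ k = fund (inject₁ k) (suc k) (cong suc (sym (Fin.toℕ-inject₁ k)))
    step : ∀ (k : Fin m) → lookup w (inject₁ k) Fin.≤ lookup w (suc k)
    step k = proj₁ (fund′ k)
    strict : ∀ (k : Fin m) → pos (suc k) < pos (inject₁ k) → lookup w (inject₁ k) Fin.< lookup w (suc k)
    strict k lt = proj₂ (fund′ k)
      -- Descents are labelled from 1 and values from 0, hence the label k + 1 for the comparison of
      -- k and k + 1.
      (subst (λ L → suc (toℕ k) ∈ descents L) (sym inverse-σ) (∈-descentsFrom⁺ 1 pos k lt))

  -- Adjacent values are a special case of `Good`; surjectivity of c provides the places where they
  -- stand.
  good⇒fundamental : Monotone w × Good c w → FundamentalWord (descentSet c) w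
  good⇒fundamental (mono , good) j (suc k) k≡1+j
    with refl ← Fin.toℕ-injective {i = j} {j = inject₁ k}
                  (trans (sym (ℕ.suc-injective k≡1+j)) (sym (Fin.toℕ-inject₁ k)))
    = mono _ _ (ℕ.<⇒≤ j<k) , λ k∈ → strict
        (∈-descentsFrom⁻ 1 pos k (subst (λ L → suc (toℕ k) ∈ descents L) inverse-σ k∈))
    where
    j<k : inject₁ k Fin.< suc k
    j<k = s≤s (ℕ.≤-reflexive (Fin.toℕ-inject₁ k))
    strict : pos (suc k) < pos (inject₁ k) → lookup w (inject₁ k) Fin.< lookup w (suc k)
    strict lt
      with permutation-surjective (injective⇒permutation c inj) (inject₁ k)
         | permutation-surjective (injective⇒permutation c inj) (suc k)
    ... | s , cₛ≡ | t , cₜ≡ = subst₂ (λ a b → lookup w a Fin.< lookup w b) cₛ≡ cₜ≡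
      (good s t (pos-anti⁻ s t (subst₂ (λ a b → pos b < pos a) (sym cₛ≡) (sym cₜ≡) lt))
        (subst₂ Fin._<_ (sym cₛ≡) (sym cₜ≡) j<k))

-- Dinv and coinversions

module Dinv (𝒜 : ℤAlgebra) where
  open ℤAlgebra 𝒜
  open Sums 𝒜

  ∑-count : ∀ {P : A → Set} (P? : Decidable P) (xs : Vec A n) →
            ∑ (allFin n) (λ j → 𝟏 (P? (lookup xs j))) ≐ const (+ count P? xs)
  ∑-count P? []       = ≐-refl
  ∑-count {n = suc n} P? (x ∷ xs) = R.trans (∑-allFin-suc n (λ j → 𝟏 (P? (lookup (x ∷ xs) j)))) (R.trans (R.+-congˡ (∑-count P? xs)) head)
    where
    head : 𝟏 (P? x) ⊕ const (+ count P? xs) ≐ const (+ count P? (x ∷ xs))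
    head with P? x
    ... | yes _ = R.sym (const-suc _)
    ... | no _  = R.+-identityˡ _

  ∑-coinv : (c : Vec (Fin m) n) →
    ∑ (allFin n) (λ i → ∑ (allFin n) λ j → 𝟏 ((i Fin.<? j) ×-dec (lookup c i Fin.<? lookup c j))) ≐
    const (+ coinv c)
  ∑-coinv []                    = ≐-refl
  ∑-coinv {m} {suc n} (x ∷ c) = begin
    ∑ (allFin (suc n)) (λ i → ∑ (allFin (suc n)) (term i))
      ≈⟨ ∑-allFin-suc n _ ⟩
    ∑ (allFin (suc n)) (term zero) ⊕ ∑ (allFin n) (λ i → ∑ (allFin (suc n)) (term (suc i)))
      ≈⟨ R.+-cong
           (R.trans (∑-allFin-suc n _) (R.+-cong
             (𝟏-no ((zero {n} Fin.<? zero {n}) ×-dec (x Fin.<? x)) λ { (() , _) })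
             (∑-cong (allFin n) λ j → 𝟏-cong ((zero {n} Fin.<? suc j) ×-dec (x Fin.<? lookup c j))
               (x Fin.<? lookup c j) proj₂ (λ lt → s≤s z≤n , lt))))
           (∑-cong (allFin n) λ i → R.trans (∑-allFin-suc n _) (R.+-cong
             (𝟏-no ((suc i Fin.<? zero {n}) ×-dec (lookup c i Fin.<? x)) λ { (() , _) })
             (∑-cong (allFin n) λ j → 𝟏-cong ((suc i Fin.<? suc j) ×-dec (lookup c i Fin.<? lookup c j))
               ((i Fin.<? j) ×-dec (lookup c i Fin.<? lookup c j))
               (λ (i<j , lt) → s≤s⁻¹ i<j , lt) (λ (i<j , lt) → s≤s i<j , lt)))) ⟩
    (const 0ℤ ⊕ ∑ (allFin n) (λ j → 𝟏 (x Fin.<? lookup c j))) ⊕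
      ∑ (allFin n) (λ i → const 0ℤ ⊕ ∑ (allFin n) λ j → 𝟏 ((i Fin.<? j) ×-dec (lookup c i Fin.<? lookup c j)))
      ≈⟨ R.+-cong
           (R.trans (R.+-identityˡ _) (∑-count (x Fin.<?_) c))
           (R.trans (∑-cong (allFin n) λ i → R.+-identityˡ _) (∑-coinv c)) ⟩
    const (+ count (x Fin.<?_) c) ⊕ const (+ coinv c)
      ≈⟨ const-+ (+ count (x Fin.<?_) c) (+ coinv c) ⟨
    const (+ coinv (x ∷ c)) ∎
    where
    open ≐-Reasoning
    term : Fin (suc n) → Fin (suc n) → K
    term i j = 𝟏 ((i Fin.<? j) ×-dec (lookup (x ∷ c) i Fin.<? lookup (x ∷ c) j))

  -- With all areas 0, the first kind of dinv is an increasing pair and the second would require 0 =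
  -- 1.
  const-dinv : (c : Vec (Fin m) m) → const (+ dinv (zeroAreaPath m) c) ≐ const (+ coinv c)
  const-dinv {m} c = begin
    const (+ dinv D c)
      ≈⟨ const-length-filter (isDinv? D c) (cartesianProduct (allFin m) (allFin m)) ⟩
    ∑ (cartesianProduct (allFin m) (allFin m)) (λ ij → 𝟏 (isDinv? D c ij))
      ≈⟨ ∑-cartesianProductWith _,_ (allFin m) (allFin m) _ ⟩
    ∑ (allFin m) (λ i → ∑ (allFin m) λ j → 𝟏 (isDinv? D c (i , j)))
      ≈⟨ ∑-cong (allFin m) (λ i → ∑-cong (allFin m) λ j →
           𝟏-cong (isDinv? D c (i , j)) ((i Fin.<? j) ×-dec (lookup c i Fin.<? lookup c j)) to from) ⟩
    ∑ (allFin m) (λ i → ∑ (allFin m) λ j → 𝟏 ((i Fin.<? j) ×-dec (lookup c i Fin.<? lookup c j)))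
      ≈⟨ ∑-coinv c ⟩
    const (+ coinv c) ∎
    where
    open ≐-Reasoning
    D = zeroAreaPath m
    to : ∀ {i j} → IsDinv D c (i , j) → i Fin.< j × lookup c i Fin.< lookup c j
    to         (i<j , inj₁ (_ , lt))     = i<j , lt
    to {i} {j} (i<j , inj₂ (aᵢ≡1+aⱼ , _)) =
      contradiction (trans (sym (area-zeroAreaPath m i)) aᵢ≡1+aⱼ) λ ()
    from : ∀ {i j} → i Fin.< j × lookup c i Fin.< lookup c j → IsDinv D c (i , j)
    from {i} {j} (i<j , lt) =
      i<j , inj₁ (trans (area-zeroAreaPath m i) (sym (area-zeroAreaPath m j)) , lt)

-- q-multinomial coefficients

module QMultinomials (𝒬 : QAlgebra) where
  open QAlgebra 𝒬
  open Sums algebra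
  open ContentSums algebra

  ∑-words-avoids : ∀ x n (f : Vec (Fin (suc m)) n → K) →
    ∑ (words (allFin (suc m)) n) (λ c → 𝟏 (avoids? x c) ⊗ f c) ≐
    ∑ (words (allFin m) n) (f ∘ Vec.map (punchIn x))
  ∑-words-avoids x zero f = R.+-congʳ (𝟏-yes-⊗ (avoids? x []) (f []) λ ())
  ∑-words-avoids {m} x (suc n) f = begin
    ∑ (words (allFin (suc m)) (suc n)) (λ c → 𝟏 (avoids? x c) ⊗ f c)
      ≈⟨ ∑-words-suc (allFin (suc m)) n _ ⟩
    ∑ (allFin (suc m)) (λ y → ∑ (words (allFin (suc m)) n) λ c → 𝟏 (avoids? x (y ∷ c)) ⊗ f (y ∷ c))
      ≈⟨ ∑-cong (allFin (suc m)) (λ y → ∑-cong (words (allFin (suc m)) n) λ c → split y c) ⟩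
    ∑ (allFin (suc m)) (λ y → ∑ (words (allFin (suc m)) n) λ c →
      𝟏 (¬? (x Fin.≟ y)) ⊗ (𝟏 (avoids? x c) ⊗ f (y ∷ c)))
      ≈⟨ ∑-cong (allFin (suc m)) (λ y → ∑-⊗ˡ (words (allFin (suc m)) n) _ _) ⟨
    ∑ (allFin (suc m)) (λ y → 𝟏 (¬? (x Fin.≟ y)) ⊗
      ∑ (words (allFin (suc m)) n) λ c → 𝟏 (avoids? x c) ⊗ f (y ∷ c))
      ≈⟨ ∑-punchIn x _ ⟩
    ∑ (allFin m) (λ y → ∑ (words (allFin (suc m)) n) λ c → 𝟏 (avoids? x c) ⊗ f (punchIn x y ∷ c))
      ≈⟨ ∑-cong (allFin m) (λ y → ∑-words-avoids x n (f ∘ (punchIn x y ∷_))) ⟩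
    ∑ (allFin m) (λ y → ∑ (words (allFin m) n) λ c → f (Vec.map (punchIn x) (y ∷ c)))
      ≈⟨ ∑-words-suc (allFin m) n _ ⟨
    ∑ (words (allFin m) (suc n)) (f ∘ Vec.map (punchIn x)) ∎
    where
    open ≐-Reasoning
    split : ∀ y c → 𝟏 (avoids? x (y ∷ c)) ⊗ f (y ∷ c) ≐
                    𝟏 (¬? (x Fin.≟ y)) ⊗ (𝟏 (avoids? x c) ⊗ f (y ∷ c))
    split y c = R.trans
      (R.*-congʳ (R.trans
        (𝟏-cong (avoids? x (y ∷ c)) (¬? (x Fin.≟ y) ×-dec avoids? x c)
          (λ av → av zero , av ∘ suc) (λ { (a , av) zero → a ; (a , av) (suc i) → av i }))
        (𝟏-× (¬? (x Fin.≟ y)) (avoids? x c))))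
      (R.*-assoc _ _ _)

  -- The letters after x avoid x, so they form the image under `punchIn x` of an injective word over
  -- one letter less.
  ∑-injective-suc : ∀ (f : Vec (Fin (suc m)) (suc n) → K) →
    ∑ (words (allFin (suc m)) (suc n)) (λ c → 𝟏 (injective? c) ⊗ f c) ≐
    ∑ (allFin (suc m)) (λ x → ∑ (words (allFin m) n) λ c →
      𝟏 (injective? c) ⊗ f (x ∷ Vec.map (punchIn x) c))
  ∑-injective-suc {m} {n} f = begin
    ∑ (words (allFin (suc m)) (suc n)) (λ c → 𝟏 (injective? c) ⊗ f c)
      ≈⟨ ∑-words-suc (allFin (suc m)) n _ ⟩
    ∑ (allFin (suc m)) (λ x → ∑ (words (allFin (suc m)) n) λ c → 𝟏 (injective? (x ∷ c)) ⊗ f (x ∷ c))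
      ≈⟨ ∑-cong (allFin (suc m)) (λ x → ∑-cong (words (allFin (suc m)) n) λ c → split x c) ⟩
    ∑ (allFin (suc m)) (λ x → ∑ (words (allFin (suc m)) n) λ c →
      𝟏 (avoids? x c) ⊗ (𝟏 (injective? c) ⊗ f (x ∷ c)))
      ≈⟨ ∑-cong (allFin (suc m)) (λ x → ∑-words-avoids x n _) ⟩
    ∑ (allFin (suc m)) (λ x → ∑ (words (allFin m) n) λ c →
      𝟏 (injective? (Vec.map (punchIn x) c)) ⊗ f (x ∷ Vec.map (punchIn x) c))
      ≈⟨ ∑-cong (allFin (suc m)) (λ x → ∑-cong (words (allFin m) n) λ c → R.*-congʳ
           (𝟏-cong (injective? (Vec.map (punchIn x) c)) (injective? c)
             (injective-punchIn⁻ x c) (injective-punchIn⁺ x c))) ⟩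
    ∑ (allFin (suc m)) (λ x → ∑ (words (allFin m) n) λ c →
      𝟏 (injective? c) ⊗ f (x ∷ Vec.map (punchIn x) c)) ∎
    where
    open ≐-Reasoning
    split : ∀ x c → 𝟏 (injective? (x ∷ c)) ⊗ f (x ∷ c) ≐
                    𝟏 (avoids? x c) ⊗ (𝟏 (injective? c) ⊗ f (x ∷ c))
    split x c = R.trans
      (R.*-congʳ (R.trans
        (𝟏-cong (injective? (x ∷ c)) (avoids? x c ×-dec injective? c)
          (injective-∷⁻ {x = x} {c = c}) injective-∷⁺)
        (𝟏-× (avoids? x c) (injective? c))))
      (R.*-assoc _ _ _)

  -- For weakly increasing w, the permutations counted are the shuffles of the blocks, each block
  -- being written in decreasing order. Their generating function by coinversions will be the
  -- q-multinomial coefficient.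
  shuffles : Vec (Fin ℓ) m → K
  shuffles {m = m} w = ∑ (words (allFin m) m) λ c → 𝟏 (injective? c) ⊗ (𝟏 (good? c w) ⊗ (q^ coinv c))

  shuffles-suc : ∀ (w : Vec (Fin ℓ) (suc m)) →
    shuffles w ≐ ∑ (allFin (suc m)) λ x →
      𝟏 (lastOfBlock? x w) ⊗ ((q^ (m ∸ toℕ x)) ⊗ shuffles (removeAt w x))
  shuffles-suc {m = m} w = begin
    shuffles w
      ≈⟨ ∑-injective-suc {n = m} (λ c → 𝟏 (good? c w) ⊗ (q^ coinv c)) ⟩
    ∑ (allFin (suc m)) (λ x → ∑ (words (allFin m) m) λ c →
      𝟏 (injective? c) ⊗ (𝟏 (good? (x ∷ Vec.map (punchIn x) c) w) ⊗ (q^ coinv (x ∷ Vec.map (punchIn x) c))))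
      -- The weight splits only for permutations; the indicator of injectivity makes c one.
      ≈⟨ ∑-cong (allFin (suc m)) (λ x → ∑-cong (words (allFin m) m) λ c →
           R.trans (𝟏-⊗-cong (injective? c) (λ inj → split x c (injective⇒permutation c inj)))
             (rearrange (𝟏 (injective? c)) (𝟏 (lastOfBlock? x w)) (𝟏 (good? c (removeAt w x)))
               (q^ (m ∸ toℕ x)) (q^ coinv c))) ⟩
    ∑ (allFin (suc m)) (λ x → ∑ (words (allFin m) m) λ c →
      (𝟏 (lastOfBlock? x w) ⊗ (q^ (m ∸ toℕ x))) ⊗
      (𝟏 (injective? c) ⊗ (𝟏 (good? c (removeAt w x)) ⊗ (q^ coinv c))))
      ≈⟨ ∑-cong (allFin (suc m)) (λ x → R.trans (R.sym (R.*-assoc _ _ _))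
           (∑-⊗ˡ (words (allFin m) m) (𝟏 (lastOfBlock? x w) ⊗ (q^ (m ∸ toℕ x))) _)) ⟨
    ∑ (allFin (suc m)) (λ x →
      𝟏 (lastOfBlock? x w) ⊗ ((q^ (m ∸ toℕ x)) ⊗ shuffles (removeAt w x))) ∎
    where
    open ≐-Reasoning
    rearrange : ∀ i l g a b → i ⊗ ((l ⊗ g) ⊗ (a ⊗ b)) ≐ (l ⊗ a) ⊗ (i ⊗ (g ⊗ b))
    rearrange = solve 5 (λ i l g a b → i :* ((l :* g) :* (a :* b)) := (l :* a) :* (i :* (g :* b))) ≐-refl
    split : ∀ x c → Permutation c →
      𝟏 (good? (x ∷ Vec.map (punchIn x) c) w) ⊗ (q^ coinv (x ∷ Vec.map (punchIn x) c)) ≐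
      (𝟏 (lastOfBlock? x w) ⊗ 𝟏 (good? c (removeAt w x))) ⊗ ((q^ (m ∸ toℕ x)) ⊗ (q^ coinv c))
    split x c p = R.*-cong
      (R.trans
        (𝟏-cong (good? (x ∷ Vec.map (punchIn x) c) w) (lastOfBlock? x w ×-dec good? c (removeAt w x))
          (good-∷⁻ x p w) (good-∷⁺ x p w))
        (𝟏-× (lastOfBlock? x w) (good? c (removeAt w x))))
      (R.trans (R.reflexive (cong q^_ (coinv-∷ x p))) (q^-+ (m ∸ toℕ x) (coinv c)))

  1-q^_ : ℕ → K
  1-q^ k = const 1ℤ ⊖ (q^ k)

  -- ∏ᵥ (q;q)_{count v w}
  blocks : Vec (Fin ℓ) m → K
  blocks []      = const 1ℤ
  blocks (a ∷ w) = (1-q^ suc (count (Fin._≟ a) w)) ⊗ blocks w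

  count-removeAt-same : ∀ (w : Vec (Fin ℓ) (suc m)) x {a} → lookup w x ≡ a →
    count (Fin._≟ a) w ≡ suc (count (Fin._≟ a) (removeAt w x))
  count-removeAt-same (b ∷ w)         zero    {a} b≡a = count-yes (Fin._≟ a) w b≡a
  count-removeAt-same (b ∷ w@(_ ∷ _)) (suc x) {a} wₓ≡a with b Fin.≟ a
  ... | yes _ = cong suc (count-removeAt-same w x wₓ≡a)
  ... | no _  = count-removeAt-same w x wₓ≡a

  count-removeAt-other : ∀ (w : Vec (Fin ℓ) (suc m)) x {a} → lookup w x ≢ a →
    count (Fin._≟ a) w ≡ count (Fin._≟ a) (removeAt w x)
  count-removeAt-other (b ∷ w)         zero    {a} b≢a = count-no (Fin._≟ a) w b≢a
  count-removeAt-other (b ∷ w@(_ ∷ _)) (suc x) {a} wₓ≢a with b Fin.≟ a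
  ... | yes _ = cong suc (count-removeAt-other w x wₓ≢a)
  ... | no _  = count-removeAt-other w x wₓ≢a

  -- Each letter contributes a factor that depends on the equal letters to its right. Yet the
  -- product depends on the counts alone: deleting any one of b equal letters costs the factor 1 -
  -- q^b.
  blocks-removeAt : ∀ (w : Vec (Fin ℓ) (suc m)) x →
    blocks w ≐ (1-q^ count (Fin._≟ lookup w x) w) ⊗ blocks (removeAt w x)
  blocks-removeAt (a ∷ w) zero =
    R.*-congʳ (R.reflexive (cong 1-q^_ (sym (count-yes (Fin._≟ a) w refl))))
  blocks-removeAt (a ∷ w@(_ ∷ _)) (suc x) with a Fin.≟ lookup w x
  ... | yes refl = R.*-congˡ (R.trans (blocks-removeAt w x)
          (R.*-congʳ (R.reflexive (cong 1-q^_ (count-removeAt-same w x refl)))))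
  ... | no a≢wₓ  = begin
    (1-q^ suc (count (Fin._≟ a) w)) ⊗ blocks w
      ≈⟨ R.*-cong (R.reflexive (cong (1-q^_ ∘ suc) (count-removeAt-other w x (a≢wₓ ∘ sym))))
                  (blocks-removeAt w x) ⟩
    (1-q^ suc (count (Fin._≟ a) (removeAt w x))) ⊗
      ((1-q^ count (Fin._≟ lookup w x) w) ⊗ blocks (removeAt w x))
      ≈⟨ solve 3 (λ u v b → u :* (v :* b) := v :* (u :* b)) ≐-refl _ _ _ ⟩
    (1-q^ count (Fin._≟ lookup w x) w) ⊗
      ((1-q^ suc (count (Fin._≟ a) (removeAt w x))) ⊗ blocks (removeAt w x)) ∎
    where open ≐-Reasoning

  -- What d additional copies of the letter a contribute to the count of the letter b.
  extra : Fin ℓ → Fin ℓ → ℕ → ℕ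
  extra a b d = if does (a Fin.≟ b) then d else 0

  extra-yes : ∀ {a b : Fin ℓ} d → a ≡ b → extra a b d ≡ d
  extra-yes {a = a} {b} d a≡b with a Fin.≟ b
  ... | yes _  = refl
  ... | no a≢b = contradiction a≡b a≢b

  extra-no : ∀ {a b : Fin ℓ} d → a ≢ b → extra a b d ≡ 0
  extra-no {a = a} {b} d a≢b with a Fin.≟ b
  ... | yes a≡b = contradiction a≡b a≢b
  ... | no _    = refl

  extra-0 : ∀ (a b : Fin ℓ) → extra a b 0 ≡ 0
  extra-0 a b with does (a Fin.≟ b)
  ... | true  = refl
  ... | false = refl

  count-extra : ∀ (a v : Fin ℓ) (w : Vec (Fin ℓ) m) d →
    count (Fin._≟ v) (a ∷ w) + extra a v d ≡ count (Fin._≟ v) w + extra a v (suc d)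
  count-extra a v w d with a Fin.≟ v
  ... | yes _ = sym (ℕ.+-suc _ d)
  ... | no _  = refl

  -- Telescoping over the blocks of w: the last entry x of a block has m - x
  -- larger entries after it.  For the induction on w, d further copies of the
  -- first letter have already been split off.
  telescope : ∀ a (w : Vec (Fin ℓ) m) d → Monotone (a ∷ w) →
    ∑ (allFin (suc m)) (λ x → 𝟏 (lastOfBlock? x (a ∷ w)) ⊗ ((q^ (m ∸ toℕ x)) ⊗
      (1-q^ (count (Fin._≟ lookup (a ∷ w) x) (a ∷ w) + extra a (lookup (a ∷ w) x) d)))) ≐
    1-q^ (suc m + d)
  telescope a [] d mono = begin
    𝟏 (lastOfBlock? zero (a ∷ [])) ⊗ ((q^ 0) ⊗
      (1-q^ (count (Fin._≟ a) (a ∷ []) + extra a a d))) ⊕ const 0ℤ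
      ≈⟨ R.+-identityʳ _ ⟩
    𝟏 (lastOfBlock? zero (a ∷ [])) ⊗ ((q^ 0) ⊗ (1-q^ (count (Fin._≟ a) (a ∷ []) + extra a a d)))
      ≈⟨ 𝟏-yes-⊗ (lastOfBlock? zero (a ∷ [])) _ (λ { zero () ; (suc ()) _ }) ⟩
    (q^ 0) ⊗ (1-q^ (count (Fin._≟ a) (a ∷ []) + extra a a d))
      ≈⟨ R.trans (R.*-congʳ q^-0) (R.*-identityˡ _) ⟩
    1-q^ (count (Fin._≟ a) (a ∷ []) + extra a a d)
      ≡⟨ cong 1-q^_ (cong₂ _+_ (count-yes (Fin._≟ a) [] refl) (extra-yes d (refl {x = a}))) ⟩
    1-q^ (1 + d) ∎
    where open ≐-Reasoning
  telescope {m = suc m} a (b ∷ w) d mono = R.trans (∑-allFin-suc (suc m) _) (go (a Fin.≟ b))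
    where
    open ≐-Reasoning
    aw = a ∷ b ∷ w
    bw = b ∷ w
    term : ∀ x → K
    term x = 𝟏 (lastOfBlock? x aw) ⊗ ((q^ (suc m ∸ toℕ x)) ⊗
      (1-q^ (count (Fin._≟ lookup aw x) aw + extra a (lookup aw x) d)))
    term′ : ℕ → ∀ x → K
    term′ d x = 𝟏 (lastOfBlock? x bw) ⊗ ((q^ (m ∸ toℕ x)) ⊗
      (1-q^ (count (Fin._≟ lookup bw x) bw + extra b (lookup bw x) d)))

    last-suc : ∀ x → 𝟏 (lastOfBlock? (suc x) aw) ≐ 𝟏 (lastOfBlock? x bw)
    last-suc x = 𝟏-cong (lastOfBlock? (suc x) aw) (lastOfBlock? x bw)
      (λ last y x<y → last (suc y) (s≤s x<y)) (λ { last (suc y) (s≤s x<y) → last y x<y })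

    term-suc : ∀ d′ x →
      count (Fin._≟ lookup bw x) aw + extra a (lookup bw x) d ≡
      count (Fin._≟ lookup bw x) bw + extra b (lookup bw x) d′ → term (suc x) ≐ term′ d′ x
    term-suc d′ x eq = R.*-cong (last-suc x) (R.*-congˡ (R.reflexive (cong 1-q^_ eq)))

    go : Dec (a ≡ b) → term zero ⊕ ∑ (allFin (suc m)) (term ∘ suc) ≐ 1-q^ (suc (suc m) + d)
    -- The first place is not the last of its block: its term vanishes, and its letter joins the
    -- copies counted by d.
    go (yes refl) = begin
      term zero ⊕ ∑ (allFin (suc m)) (term ∘ suc)
        ≈⟨ R.+-cong
             (𝟏-no-⊗ (lastOfBlock? zero aw) _ λ last → ℕ.<-irrefl refl (last (suc zero) (s≤s z≤n)))
             (∑-cong (allFin (suc m)) λ x → term-suc (suc d) x (counts x)) ⟩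
      const 0ℤ ⊕ ∑ (allFin (suc m)) (term′ (suc d))
        ≈⟨ R.+-identityˡ _ ⟩
      ∑ (allFin (suc m)) (term′ (suc d))
        ≈⟨ telescope b w (suc d) (monotone-tail {w = bw} mono) ⟩
      1-q^ (suc m + suc d)
        ≡⟨ cong 1-q^_ (ℕ.+-suc (suc m) d) ⟩
      1-q^ (suc (suc m) + d) ∎
      where
      counts : ∀ x → count (Fin._≟ lookup bw x) aw + extra a (lookup bw x) d ≡
                     count (Fin._≟ lookup bw x) bw + extra a (lookup bw x) (suc d)
      counts x = count-extra a (lookup bw x) bw d
    -- The block of a ends here with d + 1 copies in all. Its term q^(m+1) (1 - q^(d+1)) and the
    -- remaining sum 1 - q^(m+1) add up to 1 - q^(m+d+2).
    go (no a≢b) = begin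
      term zero ⊕ ∑ (allFin (suc m)) (term ∘ suc)
        ≈⟨ R.+-cong
             (𝟏-yes-⊗ (lastOfBlock? zero aw) _ λ { (suc y) _ → a<bw y })
             (∑-cong (allFin (suc m)) λ x → term-suc 0 x (counts x)) ⟩
      (q^ suc m) ⊗ (1-q^ (count (Fin._≟ a) aw + extra a a d)) ⊕ ∑ (allFin (suc m)) (term′ 0)
        ≈⟨ R.+-cong
             (R.*-congˡ {q^ suc m} (R.reflexive (cong 1-q^_ (cong₂ _+_ head-count (extra-yes d (refl {x = a}))))))
             (R.trans (telescope b w 0 (monotone-tail {w = bw} mono))
               (R.reflexive (cong 1-q^_ (ℕ.+-identityʳ (suc m))))) ⟩
      (q^ suc m) ⊗ (1-q^ suc d) ⊕ (1-q^ suc m)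
        ≈⟨ solve 2 (λ u v → u :* (con 1ℤ :- v) :+ (con 1ℤ :- u) := con 1ℤ :- u :* v) ≐-refl _ _ ⟩
      const 1ℤ ⊖ (q^ suc m) ⊗ (q^ suc d)
        ≈⟨ R.+-congˡ (R.-‿cong (q^-+ (suc m) (suc d))) ⟨
      1-q^ (suc m + suc d)
        ≡⟨ cong 1-q^_ (ℕ.+-suc (suc m) d) ⟩
      1-q^ (suc (suc m) + d) ∎
      where
      a<bw : ∀ y → a Fin.< lookup bw y
      a<bw y = ℕ.<-≤-trans
        (ℕ.≤∧≢⇒< (mono zero (suc zero) z≤n) (a≢b ∘ Fin.toℕ-injective))
        (mono (suc zero) (suc y) (s≤s z≤n))
      a≢bw : ∀ y → a ≢ lookup bw y
      a≢bw y a≡ = ℕ.<⇒≢ (a<bw y) (cong toℕ a≡)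
      head-count : count (Fin._≟ a) aw ≡ 1
      head-count = trans (count-yes (Fin._≟ a) bw refl)
        (cong suc (count-none (Fin._≟ a) bw (λ i eq → a≢bw i (sym eq))))
      counts : ∀ x → count (Fin._≟ lookup bw x) aw + extra a (lookup bw x) d ≡
                     count (Fin._≟ lookup bw x) bw + extra b (lookup bw x) 0
      counts x = cong₂ _+_ (count-no (Fin._≟ lookup bw x) bw (a≢bw x))
        (trans (extra-no d (a≢bw x)) (sym (extra-0 b (lookup bw x))))

  -- The q-multinomial formula with its denominator cleared. In the term of x, `blocks w` yields a
  -- factor 1 - q^b, with b the size of the block of x, and leaves the product to which the
  -- induction hypothesis applies; `telescope` with d = 0 adds up the factors.
  shuffles-blocks : ∀ {m} (w : Vec (Fin ℓ) m) → Monotone w → shuffles w ⊗ blocks w ≐ qPoch m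
  shuffles-blocks {ℓ} {zero} [] mono = begin
    (𝟏 (injective? {m = 0} []) ⊗ (𝟏 (good? {m = 0} {ℓ = ℓ} [] []) ⊗ (q^ 0)) ⊕ const 0ℤ) ⊗ const 1ℤ
      ≈⟨ R.trans (R.*-identityʳ _) (R.+-identityʳ _) ⟩
    𝟏 (injective? {m = 0} []) ⊗ (𝟏 (good? {m = 0} {ℓ = ℓ} [] []) ⊗ (q^ 0))
      ≈⟨ R.trans (𝟏-yes-⊗ (injective? {m = 0} []) _ (λ ())) (𝟏-yes-⊗ (good? {m = 0} {ℓ = ℓ} [] []) _ (λ ())) ⟩
    q^ 0                       ≈⟨ q^-0 ⟩
    const 1ℤ                   ≈⟨ qPoch-zero ⟨
    qPoch 0 ∎
    where open ≐-Reasoning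
  shuffles-blocks {m = suc m} w@(a ∷ w′) mono = begin
    shuffles w ⊗ blocks w
      ≈⟨ R.*-congʳ (shuffles-suc w) ⟩
    ∑ (allFin (suc m)) (λ x →
      𝟏 (lastOfBlock? x w) ⊗ ((q^ (m ∸ toℕ x)) ⊗ shuffles (removeAt w x))) ⊗ blocks w
      ≈⟨ ∑-⊗ʳ (allFin (suc m)) (blocks w) _ ⟩
    ∑ (allFin (suc m)) (λ x →
      𝟏 (lastOfBlock? x w) ⊗ ((q^ (m ∸ toℕ x)) ⊗ shuffles (removeAt w x)) ⊗ blocks w)
      ≈⟨ ∑-cong (allFin (suc m)) (λ x → step x) ⟩
    ∑ (allFin (suc m)) (λ x → 𝟏 (lastOfBlock? x w) ⊗ ((q^ (m ∸ toℕ x)) ⊗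
      (1-q^ (count (Fin._≟ lookup w x) w + extra a (lookup w x) 0))) ⊗ qPoch m)
      ≈⟨ ∑-⊗ʳ (allFin (suc m)) (qPoch m) _ ⟨
    ∑ (allFin (suc m)) (λ x → 𝟏 (lastOfBlock? x w) ⊗ ((q^ (m ∸ toℕ x)) ⊗
      (1-q^ (count (Fin._≟ lookup w x) w + extra a (lookup w x) 0)))) ⊗ qPoch m
      ≈⟨ R.*-congʳ (telescope a w′ 0 mono) ⟩
    (1-q^ (suc m + 0)) ⊗ qPoch m
      ≡⟨ cong (λ k → (1-q^ k) ⊗ qPoch m) (ℕ.+-identityʳ (suc m)) ⟩
    (1-q^ suc m) ⊗ qPoch m
      ≈⟨ R.trans (qPoch-suc m) (R.*-comm (qPoch m) _) ⟨
    qPoch (suc m) ∎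
    where
    open ≐-Reasoning
    step : ∀ x → 𝟏 (lastOfBlock? x w) ⊗ ((q^ (m ∸ toℕ x)) ⊗ shuffles (removeAt w x)) ⊗ blocks w ≐
                 𝟏 (lastOfBlock? x w) ⊗ ((q^ (m ∸ toℕ x)) ⊗
                   (1-q^ (count (Fin._≟ lookup w x) w + extra a (lookup w x) 0))) ⊗ qPoch m
    step x = begin
      𝟏 (lastOfBlock? x w) ⊗ ((q^ (m ∸ toℕ x)) ⊗ shuffles (removeAt w x)) ⊗ blocks w
        ≈⟨ R.*-congˡ (blocks-removeAt w x) ⟩
      𝟏 (lastOfBlock? x w) ⊗ ((q^ (m ∸ toℕ x)) ⊗ shuffles (removeAt w x)) ⊗
        ((1-q^ count (Fin._≟ lookup w x) w) ⊗ blocks (removeAt w x))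
        ≈⟨ solve 5 (λ l u s v b → l :* (u :* s) :* (v :* b) := l :* (u :* v) :* (s :* b)) ≐-refl _ _ _ _ _ ⟩
      𝟏 (lastOfBlock? x w) ⊗ ((q^ (m ∸ toℕ x)) ⊗ (1-q^ count (Fin._≟ lookup w x) w)) ⊗
        (shuffles (removeAt w x) ⊗ blocks (removeAt w x))
        ≈⟨ R.*-cong
             (R.*-congˡ {𝟏 (lastOfBlock? x w)} (R.*-congˡ {q^ (m ∸ toℕ x)} (R.reflexive (cong 1-q^_
               (sym (trans (cong (_+_ (count (Fin._≟ lookup w x) w)) (extra-0 a (lookup w x))) (ℕ.+-identityʳ _)))))))
             (shuffles-blocks (removeAt w x) (monotone-removeAt w x mono)) ⟩
      𝟏 (lastOfBlock? x w) ⊗ ((q^ (m ∸ toℕ x)) ⊗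
        (1-q^ (count (Fin._≟ lookup w x) w + extra a (lookup w x) 0))) ⊗ qPoch m ∎

  ∑-cong-∈ : ∀ (is : List A) {f g : A → K} → (∀ {i} → i ∈ is → f i ≐ g i) → ∑ is f ≐ ∑ is g
  ∑-cong-∈ []       f≐g = ≐-refl
  ∑-cong-∈ (i ∷ is) f≐g = R.+-cong (f≐g (here refl)) (∑-cong-∈ is (f≐g ∘ there))

  -- Products over the variables

  ∏ : Monomial → (ℕ → K) → K
  ∏ β f = foldr (λ b p → f b ⊗ p) (const 1ℤ) β

  ∏-cong : ∀ β {f g : ℕ → K} → (∀ b → f b ≐ g b) → ∏ β f ≐ ∏ β g
  ∏-cong []      f≐g = ≐-refl
  ∏-cong (b ∷ β) f≐g = R.*-cong (f≐g b) (∏-cong β f≐g)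

  ∏-⊗ : ∀ β (f g : ℕ → K) → ∏ β (λ b → f b ⊗ g b) ≐ ∏ β f ⊗ ∏ β g
  ∏-⊗ []      f g = R.sym (R.*-identityˡ _)
  ∏-⊗ (b ∷ β) f g = R.trans (R.*-congˡ (∏-⊗ β f g))
    (solve 4 (λ a b c d → (a :* b) :* (c :* d) := (a :* c) :* (b :* d)) ≐-refl _ _ _ _)

  ∏-const1 : ∀ β {f : ℕ → K} → (∀ b → f b ≐ const 1ℤ) → ∏ β f ≐ const 1ℤ
  ∏-const1 []      f≐1 = ≐-refl
  ∏-const1 (b ∷ β) f≐1 = R.trans (R.*-cong (f≐1 b) (∏-const1 β f≐1)) (R.*-identityˡ _)

  ∏-q^ : ∀ β → ∏ β q^_ ≐ q^ sum β
  ∏-q^ []      = R.sym q^-0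
  ∏-q^ (b ∷ β) = R.trans (R.*-congˡ (∏-q^ β)) (R.sym (q^-+ b (sum β)))

  blocks-map-suc : (w : Vec (Fin ℓ) n) → blocks (Vec.map suc w) ≐ blocks w
  blocks-map-suc []      = ≐-refl
  blocks-map-suc (a ∷ w) = R.*-cong
    (R.reflexive (cong (1-q^_ ∘ suc) (trans (count-map (Fin._≟ suc a) suc w)
      (count-cong _ (Fin._≟ a) (λ _ → Fin.suc-injective) (λ _ → cong suc) w))))
    (blocks-map-suc w)

  blocks-sorted : ∀ β → blocks (sorted β) ≐ ∏ β qPoch
  blocks-sorted []      = ≐-refl
  blocks-sorted (b ∷ β) = R.trans (prepend b) (R.*-congˡ (blocks-sorted β))
    where
    prepend : ∀ b → blocks (sorted (b ∷ β)) ≐ qPoch b ⊗ blocks (sorted β)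
    prepend zero    = R.trans (blocks-map-suc (sorted β))
      (R.sym (R.trans (R.*-congʳ qPoch-zero) (R.*-identityˡ _)))
    prepend (suc b) = begin
      (1-q^ suc (count (Fin._≟ zero) (sorted (b ∷ β)))) ⊗ blocks (sorted (b ∷ β))
        ≈⟨ R.*-cong (R.reflexive (cong (1-q^_ ∘ suc) (sorted-hasMonomial (b ∷ β) zero))) (prepend b) ⟩
      (1-q^ suc b) ⊗ (qPoch b ⊗ blocks (sorted β))
        ≈⟨ solve 3 (λ x y z → x :* (y :* z) := y :* x :* z) ≐-refl _ _ _ ⟩
      qPoch b ⊗ (1-q^ suc b) ⊗ blocks (sorted β)
        ≈⟨ R.*-congʳ (qPoch-suc b) ⟨
      qPoch (suc b) ⊗ blocks (sorted β) ∎
      where open ≐-Reasoning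

  shuffles-sorted : ∀ β → shuffles (sorted β) ≐ qPoch (sum β) ⊗ ∏ β qPoch⁻¹
  shuffles-sorted β = begin
    shuffles (sorted β)
      ≈⟨ R.*-identityʳ _ ⟨
    shuffles (sorted β) ⊗ const 1ℤ
      ≈⟨ R.*-congˡ (R.trans (R.sym (∏-⊗ β qPoch qPoch⁻¹)) (∏-const1 β qPoch-inverse)) ⟨
    shuffles (sorted β) ⊗ (∏ β qPoch ⊗ ∏ β qPoch⁻¹)
      ≈⟨ R.*-assoc _ _ _ ⟨
    shuffles (sorted β) ⊗ ∏ β qPoch ⊗ ∏ β qPoch⁻¹
      ≈⟨ R.*-congʳ (R.*-congˡ (blocks-sorted β)) ⟨
    shuffles (sorted β) ⊗ blocks (sorted β) ⊗ ∏ β qPoch⁻¹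
      ≈⟨ R.*-congʳ (shuffles-blocks (sorted β) (sorted-monotone β)) ⟩
    qPoch (sum β) ⊗ ∏ β qPoch⁻¹ ∎
    where open ≐-Reasoning

  -- The coefficient at x^β of (q;q)_m h_m[X/(1-q)]; the indicator expresses homogeneity.
  qMultinomial : ℕ → Monomial → K
  qMultinomial m β = 𝟏 (sum β ℕ.≟ m) ⊗ (qPoch m ⊗ ∏ β qPoch⁻¹)

  -- After exchanging the sums over cars and words, the inner sum is `shuffles w` and the outer one
  -- reduces to w = `sorted β`. Equality of the two statistics is a hypothesis since it concerns
  -- natural numbers, and `const` of an abstract ring may fail to be injective.
  LLT-coefficient : (∀ {m} (c : Vec (Fin (suc m)) (suc m)) → dinv (zeroAreaPath (suc m)) c ≡ coinv c) →
    ∀ m β →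
    ∑ (parkingFunctions (zeroAreaPath (suc m))) (λ c → (q^ dinv (zeroAreaPath (suc m)) c) ⊗
      const (+ length (filter (λ w → hasMonomial? β w ×-dec fundamentalWord? (descentSet c) w)
                              (words (allFin (length β)) (suc m))))) ≐
    qMultinomial (suc m) β
  LLT-coefficient dinv≡coinv m β = begin
    ∑ (parkingFunctions D) (λ c → (q^ dinv D c) ⊗ const (+ length (filter (P? c) ws)))
      ≈⟨ ∑-filter (isParkingFunction? D) cs _ ⟩
    ∑ cs (λ c → 𝟏 (isParkingFunction? D c) ⊗
      ((q^ dinv D c) ⊗ const (+ length (filter (P? c) ws))))
      ≈⟨ ∑-cong cs (λ c → R.*-congˡ (R.*-congˡ (const-length-filter (P? c) ws))) ⟩
    ∑ cs (λ c → 𝟏 (isParkingFunction? D c) ⊗ ((q^ dinv D c) ⊗ ∑ ws (λ w → 𝟏 (P? c w))))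
      ≈⟨ ∑-cong cs (λ c → R.trans (R.*-congˡ (∑-⊗ˡ ws _ _)) (∑-⊗ˡ ws _ _)) ⟩
    ∑ cs (λ c → ∑ ws (λ w → 𝟏 (isParkingFunction? D c) ⊗ ((q^ dinv D c) ⊗ 𝟏 (P? c w))))
      ≈⟨ ∑-cong cs (λ c → ∑-cong ws λ w → term c w) ⟩
    ∑ cs (λ c → ∑ ws (λ w → 𝟏 (hasMonomial? β w ×-dec monotone? w) ⊗
      (𝟏 (injective? c) ⊗ (𝟏 (good? c w) ⊗ (q^ coinv c)))))
      ≈⟨ ∑-swap cs ws _ ⟩
    ∑ ws (λ w → ∑ cs (λ c → 𝟏 (hasMonomial? β w ×-dec monotone? w) ⊗
      (𝟏 (injective? c) ⊗ (𝟏 (good? c w) ⊗ (q^ coinv c)))))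
      ≈⟨ ∑-cong ws (λ w → ∑-⊗ˡ cs _ _) ⟨
    ∑ ws (λ w → 𝟏 (hasMonomial? β w ×-dec monotone? w) ⊗ shuffles w)
      ≈⟨ ∑-monotone β (suc m) shuffles ⟩
    𝟏 (sum β ℕ.≟ suc m) ⊗ shuffles (sorted β)
      ≈⟨ 𝟏-⊗-cong (sum β ℕ.≟ suc m) (λ ∑β≡ → R.trans (shuffles-sorted β)
           (R.*-congʳ (R.reflexive (cong qPoch ∑β≡)))) ⟩
    qMultinomial (suc m) β ∎
    where
    open ≐-Reasoning
    D  = zeroAreaPath (suc m)
    cs = words (allFin (suc m)) (suc m)
    ws = words (allFin (length β)) (suc m)
    P? = λ c (w : Vec (Fin (length β)) (suc m)) → hasMonomial? β w ×-dec fundamentalWord? (descentSet c) w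
    term : ∀ c w → 𝟏 (isParkingFunction? D c) ⊗ ((q^ dinv D c) ⊗ 𝟏 (P? c w)) ≐
                   𝟏 (hasMonomial? β w ×-dec monotone? w) ⊗
                     (𝟏 (injective? c) ⊗ (𝟏 (good? c w) ⊗ (q^ coinv c)))
    term c w = begin
      𝟏 (isParkingFunction? D c) ⊗ ((q^ dinv D c) ⊗ 𝟏 (P? c w))
        ≈⟨ R.*-cong (𝟏-cong (isParkingFunction? D c) (injective? c) proj₁ (injective⇒parking c))
                    (R.*-congʳ (R.reflexive (cong q^_ (dinv≡coinv c)))) ⟩
      𝟏 (injective? c) ⊗ ((q^ coinv c) ⊗ 𝟏 (P? c w))
        ≈⟨ 𝟏-⊗-cong (injective? c) (λ inj → R.*-congˡ (fundamental inj)) ⟩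
      𝟏 (injective? c) ⊗ ((q^ coinv c) ⊗ (𝟏 (hasMonomial? β w ×-dec monotone? w) ⊗ 𝟏 (good? c w)))
        ≈⟨ solve 4 (λ i q h g → i :* (q :* (h :* g)) := h :* (i :* (g :* q))) ≐-refl _ _ _ _ ⟩
      𝟏 (hasMonomial? β w ×-dec monotone? w) ⊗ (𝟏 (injective? c) ⊗ (𝟏 (good? c w) ⊗ (q^ coinv c))) ∎
      where
      fundamental : Injective c → 𝟏 (P? c w) ≐ 𝟏 (hasMonomial? β w ×-dec monotone? w) ⊗ 𝟏 (good? c w)
      fundamental inj = R.trans
        (𝟏-cong (P? c w) ((hasMonomial? β w ×-dec monotone? w) ×-dec good? c w)
          (λ (has , fund) → let mono , good = fundamental⇒good c inj w fund in (has , mono) , good)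
          (λ ((has , mono) , good) → has , good⇒fundamental c inj w (mono , good)))
        (𝟏-× (hasMonomial? β w ×-dec monotone? w) (good? c w))

  -- A factorisation of x^β chooses the exponent of each variable independently, so the distributive
  -- law applies.
  ∑-factorisations : ∀ β (f g : ℕ → K) →
    ∑ (factorisations β) (λ p → ∏ (proj₁ p) f ⊗ ∏ (proj₂ p) g) ≐
    ∏ β (λ b → ∑ (upTo (suc b)) (λ i → f i ⊗ g (b ∸ i)))
  ∑-factorisations []      f g = R.trans (R.+-identityʳ _) (R.*-identityˡ _)
  ∑-factorisations (b ∷ β) f g = begin
    ∑ (factorisations (b ∷ β)) (λ p → ∏ (proj₁ p) f ⊗ ∏ (proj₂ p) g)
      ≈⟨ ∑-cartesianProductWith _ (upTo (suc b)) (factorisations β) _ ⟩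
    ∑ (upTo (suc b)) (λ i → ∑ (factorisations β) λ p →
      (f i ⊗ ∏ (proj₁ p) f) ⊗ (g (b ∸ i) ⊗ ∏ (proj₂ p) g))
      ≈⟨ ∑-cong (upTo (suc b)) (λ i → R.trans
           (∑-cong (factorisations β) λ p →
             solve 4 (λ a b c d → (a :* b) :* (c :* d) := (a :* c) :* (b :* d)) ≐-refl _ _ _ _)
           (R.sym (∑-⊗ˡ (factorisations β) (f i ⊗ g (b ∸ i)) _))) ⟩
    ∑ (upTo (suc b)) (λ i → f i ⊗ g (b ∸ i) ⊗
      ∑ (factorisations β) (λ p → ∏ (proj₁ p) f ⊗ ∏ (proj₂ p) g))
      ≈⟨ ∑-⊗ʳ (upTo (suc b)) _ _ ⟨
    ∑ (upTo (suc b)) (λ i → f i ⊗ g (b ∸ i)) ⊗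
      ∑ (factorisations β) (λ p → ∏ (proj₁ p) f ⊗ ∏ (proj₂ p) g)
      ≈⟨ R.*-congˡ (∑-factorisations β f g) ⟩
    ∏ (b ∷ β) (λ b → ∑ (upTo (suc b)) (λ i → f i ⊗ g (b ∸ i))) ∎
    where open ≐-Reasoning

  sum-factorisations : ∀ β → All (λ p → sum (proj₁ p) + sum (proj₂ p) ≡ sum β) (factorisations β)
  sum-factorisations []      = refl ∷ []
  sum-factorisations (b ∷ β) = All.cartesianProductWith⁺ (setoid _) (setoid _) _ (upTo (suc b)) (factorisations β)
    λ {i} {p} i∈ p∈ → let γ = proj₁ p ; δ = proj₂ p in begin
      i + sum γ + (b ∸ i + sum δ)      ≡⟨ ℕ.+-assoc i (sum γ) _ ⟩
      i + (sum γ + (b ∸ i + sum δ))    ≡⟨ cong (_+_ i) (ℕ.+-assoc (sum γ) (b ∸ i) (sum δ)) ⟨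
      i + (sum γ + (b ∸ i) + sum δ)    ≡⟨ cong (λ x → i + (x + sum δ)) (ℕ.+-comm (sum γ) (b ∸ i)) ⟩
      i + (b ∸ i + sum γ + sum δ)      ≡⟨ cong (_+_ i) (ℕ.+-assoc (b ∸ i) (sum γ) (sum δ)) ⟩
      i + (b ∸ i + (sum γ + sum δ))    ≡⟨ ℕ.+-assoc i (b ∸ i) _ ⟨
      i + (b ∸ i) + (sum γ + sum δ)
        ≡⟨ cong₂ _+_ (ℕ.m+[n∸m]≡n (s≤s⁻¹ (∈-upTo⁻ i∈))) (All.lookup (sum-factorisations β) p∈) ⟩
      b + sum β ∎
    where open ≡-Reasoning

  -- The alternating sum and the recurrence

  sign : ℕ → K
  sign k = const (-1ℤ ℤ.^ k)

  sign-suc : ∀ k → sign (suc k) ≐ ⊖ sign k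
  sign-suc k = R.trans (R.reflexive (cong const (ℤ.-1*i≡-i (-1ℤ ℤ.^ k)))) (const-neg _)

  sign-+ : ∀ j k → sign (j + k) ≐ sign j ⊗ sign k
  sign-+ zero    k = R.sym (R.*-identityˡ _)
  sign-+ (suc j) k = begin
    sign (suc (j + k))      ≈⟨ R.trans (sign-suc (j + k)) (R.-‿cong (sign-+ j k)) ⟩
    ⊖ (sign j ⊗ sign k)     ≈⟨ solve 2 (λ a b → :- (a :* b) := :- a :* b) ≐-refl _ _ ⟩
    ⊖ sign j ⊗ sign k       ≈⟨ R.*-congʳ (sign-suc j) ⟨
    sign (suc j) ⊗ sign k   ∎
    where open ≐-Reasoning

  -- The coefficients 1, -1, 0, 0, ... of 1 - x. Multiplied over the variables they give ∏ᵢ (1 - xᵢ)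
  -- = ∑ (-1)^k e_k.
  signedE : ℕ → K
  signedE b = 𝟏 (b ℕ.≤? 1) ⊗ sign b

  ∏-signedE : ∀ γ → ∏ γ signedE ≐ 𝟏 (squarefree? γ) ⊗ sign (sum γ)
  ∏-signedE []      = R.sym (R.*-identityˡ _)
  ∏-signedE (b ∷ γ) = begin
    𝟏 (b ℕ.≤? 1) ⊗ sign b ⊗ ∏ γ signedE
      ≈⟨ R.*-congˡ (∏-signedE γ) ⟩
    𝟏 (b ℕ.≤? 1) ⊗ sign b ⊗ (𝟏 (squarefree? γ) ⊗ sign (sum γ))
      ≈⟨ solve 4 (λ a b c d → (a :* b) :* (c :* d) := (a :* c) :* (b :* d)) ≐-refl _ _ _ _ ⟩
    𝟏 (b ℕ.≤? 1) ⊗ 𝟏 (squarefree? γ) ⊗ (sign b ⊗ sign (sum γ))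
      ≈⟨ R.*-cong
           (R.trans (R.sym (𝟏-× (b ℕ.≤? 1) (squarefree? γ)))
             (𝟏-cong (b ℕ.≤? 1 ×-dec squarefree? γ) (squarefree? (b ∷ γ))
               (λ (p , ps) → p ∷ ps) (λ { (p ∷ ps) → p , ps })))
           (R.sym (sign-+ b (sum γ))) ⟩
    𝟏 (squarefree? (b ∷ γ)) ⊗ sign (b + sum γ) ∎
    where open ≐-Reasoning

  qPoch⁻¹-suc : ∀ b → qPoch⁻¹ b ≐ (1-q^ suc b) ⊗ qPoch⁻¹ (suc b)
  qPoch⁻¹-suc b = begin
    qPoch⁻¹ b
      ≈⟨ R.*-identityʳ _ ⟨
    qPoch⁻¹ b ⊗ const 1ℤ
      ≈⟨ R.*-congˡ (R.trans (R.*-congʳ (R.sym (qPoch-suc b))) (qPoch-inverse (suc b))) ⟨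
    qPoch⁻¹ b ⊗ (qPoch b ⊗ (1-q^ suc b) ⊗ qPoch⁻¹ (suc b))
      ≈⟨ solve 4 (λ i p u j → i :* (p :* u :* j) := p :* i :* (u :* j)) ≐-refl _ _ _ _ ⟩
    qPoch b ⊗ qPoch⁻¹ b ⊗ ((1-q^ suc b) ⊗ qPoch⁻¹ (suc b))
      ≈⟨ R.trans (R.*-congʳ (qPoch-inverse b)) (R.*-identityˡ _) ⟩
    (1-q^ suc b) ⊗ qPoch⁻¹ (suc b) ∎
    where open ≐-Reasoning

  -- 1/(q;q)_b - 1/(q;q)_{b-1} = q^b/(q;q)_b
  ∑-signedE : ∀ b → ∑ (upTo (suc b)) (λ i → signedE i ⊗ qPoch⁻¹ (b ∸ i)) ≐ (q^ b) ⊗ qPoch⁻¹ b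
  ∑-signedE zero = begin
    𝟏 (0 ℕ.≤? 1) ⊗ const 1ℤ ⊗ qPoch⁻¹ 0 ⊕ const 0ℤ
      ≈⟨ R.trans (R.+-identityʳ _) (R.*-congʳ (R.*-identityʳ _)) ⟩
    const 1ℤ ⊗ qPoch⁻¹ 0
      ≈⟨ R.*-congʳ q^-0 ⟨
    (q^ 0) ⊗ qPoch⁻¹ 0 ∎
    where open ≐-Reasoning
  ∑-signedE (suc b) = begin
    ∑ (upTo (suc (suc b))) (λ i → signedE i ⊗ qPoch⁻¹ (suc b ∸ i))
      ≈⟨ R.trans (∑-upTo-suc (suc b) _) (R.+-congˡ (∑-upTo-suc b _)) ⟩
    signedE 0 ⊗ qPoch⁻¹ (suc b) ⊕ (signedE 1 ⊗ qPoch⁻¹ b ⊕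
      ∑ (upTo b) (λ i → signedE (suc (suc i)) ⊗ qPoch⁻¹ (suc b ∸ suc (suc i))))
      ≈⟨ R.+-cong
           (R.*-congʳ (R.*-identityˡ _))
           (R.+-cong (R.*-congʳ (R.trans (R.*-identityˡ _) (sign-suc 0)))
             (∑-zero (upTo b) λ i → R.trans (R.*-congʳ (R.zeroˡ _)) (R.zeroˡ _))) ⟩
    const 1ℤ ⊗ qPoch⁻¹ (suc b) ⊕ (⊖ const 1ℤ ⊗ qPoch⁻¹ b ⊕ const 0ℤ)
      ≈⟨ R.+-congˡ (R.+-congʳ (R.*-congˡ (qPoch⁻¹-suc b))) ⟩
    const 1ℤ ⊗ qPoch⁻¹ (suc b) ⊕ (⊖ const 1ℤ ⊗ ((1-q^ suc b) ⊗ qPoch⁻¹ (suc b)) ⊕ const 0ℤ)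
      ≈⟨ solve 2 (λ i q → con 1ℤ :* i :+ (:- con 1ℤ :* ((con 1ℤ :- q) :* i) :+ con 0ℤ) := q :* i) ≐-refl
           (qPoch⁻¹ (suc b)) (q^ suc b) ⟩
    (q^ suc b) ⊗ qPoch⁻¹ (suc b) ∎
    where open ≐-Reasoning

  ∏-𝟏≟0 : ∀ γ → ∏ γ (λ b → 𝟏 (0 ℕ.≟ b)) ≐ 𝟏 (0 ℕ.≟ sum γ)
  ∏-𝟏≟0 []          = ≐-refl
  ∏-𝟏≟0 (zero ∷ γ)  = R.trans (R.*-identityˡ _) (∏-𝟏≟0 γ)
  ∏-𝟏≟0 (suc b ∷ γ) = R.zeroˡ _

  -- The coefficient at x^β of H(X) - ∏ᵢ (1 - xᵢ) H(X) = H(X) - H(qX), where H = ∏ᵢ 1/(xᵢ;q)_∞. The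
  -- indicator of γ = 1 is itself a product over the variables, so that `∑-factorisations` handles
  -- both parts.
  ∑-alternating : ∀ β →
    ∑ (factorisations β) (λ p →
      (𝟏 (0 ℕ.≟ sum (proj₁ p)) ⊖ 𝟏 (squarefree? (proj₁ p)) ⊗ sign (sum (proj₁ p))) ⊗ ∏ (proj₂ p) qPoch⁻¹) ≐
    (1-q^ sum β) ⊗ ∏ β qPoch⁻¹
  ∑-alternating β = begin
    ∑ (factorisations β) (λ p →
      (𝟏 (0 ℕ.≟ sum (proj₁ p)) ⊖ 𝟏 (squarefree? (proj₁ p)) ⊗ sign (sum (proj₁ p))) ⊗ ∏ (proj₂ p) qPoch⁻¹)
      ≈⟨ ∑-cong (factorisations β) (λ p → R.trans
           (R.*-congʳ (R.+-cong (R.sym (∏-𝟏≟0 (proj₁ p))) (R.-‿cong (R.sym (∏-signedE (proj₁ p))))))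
           (solve 3 (λ a b c → (a :- b) :* c := a :* c :+ :- con 1ℤ :* (b :* c)) ≐-refl _ _ _)) ⟩
    ∑ (factorisations β) (λ p → ∏ (proj₁ p) (λ b → 𝟏 (0 ℕ.≟ b)) ⊗ ∏ (proj₂ p) qPoch⁻¹ ⊕
      ⊖ const 1ℤ ⊗ (∏ (proj₁ p) signedE ⊗ ∏ (proj₂ p) qPoch⁻¹))
      ≈⟨ R.trans (∑-⊕ (factorisations β) _ _) (R.+-congˡ (R.sym (∑-⊗ˡ (factorisations β) (⊖ const 1ℤ) _))) ⟩
    ∑ (factorisations β) (λ p → ∏ (proj₁ p) (λ b → 𝟏 (0 ℕ.≟ b)) ⊗ ∏ (proj₂ p) qPoch⁻¹) ⊕
      ⊖ const 1ℤ ⊗ ∑ (factorisations β) (λ p → ∏ (proj₁ p) signedE ⊗ ∏ (proj₂ p) qPoch⁻¹)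
      ≈⟨ R.+-cong
           (R.trans (∑-factorisations β _ qPoch⁻¹)
             (∏-cong β λ b → ∑-upTo-pick {suc b} {0} (s≤s z≤n) (λ i → qPoch⁻¹ (b ∸ i))))
           (R.*-congˡ (R.trans (∑-factorisations β signedE qPoch⁻¹) (R.trans (∏-cong β ∑-signedE)
             (R.trans (∏-⊗ β q^_ qPoch⁻¹) (R.*-congʳ (∏-q^ β)))))) ⟩
    ∏ β qPoch⁻¹ ⊕ ⊖ const 1ℤ ⊗ ((q^ sum β) ⊗ ∏ β qPoch⁻¹)
      ≈⟨ solve 2 (λ l q → l :+ :- con 1ℤ :* (q :* l) := (con 1ℤ :- q) :* l) ≐-refl _ _ ⟩
    (1-q^ sum β) ⊗ ∏ β qPoch⁻¹ ∎
    where open ≐-Reasoning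

  sum≡0⇒squarefree : ∀ γ → 0 ≡ sum γ → Squarefree γ
  sum≡0⇒squarefree []         _  = []
  sum≡0⇒squarefree (zero ∷ γ) eq = z≤n ∷ sum≡0⇒squarefree γ eq

  -- The sum over k extracts k = |γ| - 1 for γ ≠ 1 and vanishes for γ = 1.
  ∑-sign : ∀ n γ → sum γ ≤ n →
    ∑ (upTo n) (λ k → 𝟏 (sum γ ℕ.≟ suc k) ⊗ (𝟏 (squarefree? γ) ⊗ sign k)) ≐
    𝟏 (0 ℕ.≟ sum γ) ⊖ 𝟏 (squarefree? γ) ⊗ sign (sum γ)
  ∑-sign n γ ∑γ≤n = go (sum γ) refl ∑γ≤n
    where
    open ≐-Reasoning
    go : ∀ s → s ≡ sum γ → s ≤ n →
      ∑ (upTo n) (λ k → 𝟏 (s ℕ.≟ suc k) ⊗ (𝟏 (squarefree? γ) ⊗ sign k)) ≐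
      𝟏 (0 ℕ.≟ s) ⊖ 𝟏 (squarefree? γ) ⊗ sign s
    go zero 0≡∑γ _ = begin
      ∑ (upTo n) (λ k → const 0ℤ ⊗ (𝟏 (squarefree? γ) ⊗ sign k))
        ≈⟨ ∑-zero (upTo n) (λ k → R.zeroˡ _) ⟩
      const 0ℤ
        ≈⟨ solve 0 (con 0ℤ := con 1ℤ :- con 1ℤ :* con 1ℤ) ≐-refl ⟩
      const 1ℤ ⊖ const 1ℤ ⊗ const 1ℤ
        ≈⟨ R.+-congˡ (R.-‿cong (R.*-congʳ (𝟏-yes (squarefree? γ) (sum≡0⇒squarefree γ 0≡∑γ)))) ⟨
      const 1ℤ ⊖ 𝟏 (squarefree? γ) ⊗ const 1ℤ ∎
    go (suc s) _ s<n = begin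
      ∑ (upTo n) (λ k → 𝟏 (suc s ℕ.≟ suc k) ⊗ (𝟏 (squarefree? γ) ⊗ sign k))
        ≈⟨ ∑-cong (upTo n) (λ k → R.*-congʳ (𝟏-cong (suc s ℕ.≟ suc k) (s ℕ.≟ k) ℕ.suc-injective (cong suc))) ⟩
      ∑ (upTo n) (λ k → 𝟏 (s ℕ.≟ k) ⊗ (𝟏 (squarefree? γ) ⊗ sign k))
        ≈⟨ ∑-upTo-pick s<n _ ⟩
      𝟏 (squarefree? γ) ⊗ sign s
        ≈⟨ solve 2 (λ a b → a :* b := con 0ℤ :- a :* (:- b)) ≐-refl _ _ ⟩
      const 0ℤ ⊖ 𝟏 (squarefree? γ) ⊗ (⊖ sign s)
        ≈⟨ R.+-congˡ (R.-‿cong (R.*-congˡ (sign-suc s))) ⟨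
      const 0ℤ ⊖ 𝟏 (squarefree? γ) ⊗ sign (suc s) ∎

  -- In the term k the three q-factors multiply to (q;q)_n, which does not depend on k; what remains
  -- of the sum over k is the sign sum `∑-sign`. Both n and k are one less than in the theorem.
  recurrence : ∀ n (qbinom : ℕ → K) →
    (∀ k → qPoch k ⊗ qbinom k ⊗ qPoch (n ∸ k) ≐ qPoch n) → ∀ β →
    qMultinomial (suc n) β ≐ ∑ (upTo (suc n)) λ k → (sign k ⊗ qPoch k ⊗ qbinom k) ⊗
      ∑ (factorisations β) λ p →
        (𝟏 (squarefree? (proj₁ p)) ⊗ 𝟏 (sum (proj₁ p) ℕ.≟ suc k)) ⊗ qMultinomial (n ∸ k) (proj₂ p)
  recurrence n qbinom hyp β = R.sym (begin
    ∑ (upTo (suc n)) (λ k → (sign k ⊗ qPoch k ⊗ qbinom k) ⊗ ∑ (factorisations β) λ p →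
      (𝟏 (squarefree? (proj₁ p)) ⊗ 𝟏 (sum (proj₁ p) ℕ.≟ suc k)) ⊗ qMultinomial (n ∸ k) (proj₂ p))
      -- Membership in the two lists supplies k ≤ n and |γ| + |δ| = |β|.
      ≈⟨ ∑-cong-∈ (upTo (suc n)) (λ {k} k∈ → R.trans (∑-⊗ˡ (factorisations β) _ _)
           (∑-cong-∈ (factorisations β) λ {p} p∈ →
             term k (s≤s⁻¹ (∈-upTo⁻ k∈)) (proj₁ p) (proj₂ p) (All.lookup (sum-factorisations β) p∈))) ⟩
    ∑ (upTo (suc n)) (λ k → ∑ (factorisations β) λ p →
      w (proj₂ p) ⊗ (𝟏 (sum (proj₁ p) ℕ.≟ suc k) ⊗ (𝟏 (squarefree? (proj₁ p)) ⊗ sign k)))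
      ≈⟨ ∑-swap (upTo (suc n)) (factorisations β) _ ⟩
    ∑ (factorisations β) (λ p → ∑ (upTo (suc n)) λ k →
      w (proj₂ p) ⊗ (𝟏 (sum (proj₁ p) ℕ.≟ suc k) ⊗ (𝟏 (squarefree? (proj₁ p)) ⊗ sign k)))
      ≈⟨ ∑-cong-∈ (factorisations β) (λ {p} p∈ → R.trans (R.sym (∑-⊗ˡ (upTo (suc n)) _ _))
           (step (proj₁ p) (proj₂ p) (All.lookup (sum-factorisations β) p∈))) ⟩
    ∑ (factorisations β) (λ p → 𝟏 (sum β ℕ.≟ suc n) ⊗ qPoch n ⊗
      ((𝟏 (0 ℕ.≟ sum (proj₁ p)) ⊖ 𝟏 (squarefree? (proj₁ p)) ⊗ sign (sum (proj₁ p))) ⊗ ∏ (proj₂ p) qPoch⁻¹))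
      ≈⟨ ∑-⊗ˡ (factorisations β) _ _ ⟨
    𝟏 (sum β ℕ.≟ suc n) ⊗ qPoch n ⊗ ∑ (factorisations β) (λ p →
      (𝟏 (0 ℕ.≟ sum (proj₁ p)) ⊖ 𝟏 (squarefree? (proj₁ p)) ⊗ sign (sum (proj₁ p))) ⊗ ∏ (proj₂ p) qPoch⁻¹)
      ≈⟨ R.*-congˡ (∑-alternating β) ⟩
    𝟏 (sum β ℕ.≟ suc n) ⊗ qPoch n ⊗ ((1-q^ sum β) ⊗ ∏ β qPoch⁻¹)
      ≈⟨ solve 4 (λ i p u l → i :* p :* (u :* l) := i :* (p :* u :* l)) ≐-refl _ _ _ _ ⟩
    𝟏 (sum β ℕ.≟ suc n) ⊗ (qPoch n ⊗ (1-q^ sum β) ⊗ ∏ β qPoch⁻¹)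
      ≈⟨ 𝟏-⊗-cong (sum β ℕ.≟ suc n) (λ ∑β≡ → R.*-congʳ (R.trans
           (R.reflexive (cong (λ s → qPoch n ⊗ (1-q^ s)) ∑β≡)) (R.sym (qPoch-suc n)))) ⟩
    qMultinomial (suc n) β ∎)
    where
    open ≐-Reasoning
    w : Monomial → K
    w δ = 𝟏 (sum β ℕ.≟ suc n) ⊗ (qPoch n ⊗ ∏ δ qPoch⁻¹)

    step : ∀ γ δ → sum γ + sum δ ≡ sum β →
      w δ ⊗ ∑ (upTo (suc n)) (λ k → 𝟏 (sum γ ℕ.≟ suc k) ⊗ (𝟏 (squarefree? γ) ⊗ sign k)) ≐
      𝟏 (sum β ℕ.≟ suc n) ⊗ qPoch n ⊗
        ((𝟏 (0 ℕ.≟ sum γ) ⊖ 𝟏 (squarefree? γ) ⊗ sign (sum γ)) ⊗ ∏ δ qPoch⁻¹)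
    step γ δ γδ≡β = begin
      w δ ⊗ ∑ (upTo (suc n)) (λ k → 𝟏 (sum γ ℕ.≟ suc k) ⊗ (𝟏 (squarefree? γ) ⊗ sign k))
        ≈⟨ R.*-assoc _ _ _ ⟩
      𝟏 (sum β ℕ.≟ suc n) ⊗ ((qPoch n ⊗ ∏ δ qPoch⁻¹) ⊗
        ∑ (upTo (suc n)) (λ k → 𝟏 (sum γ ℕ.≟ suc k) ⊗ (𝟏 (squarefree? γ) ⊗ sign k)))
        -- The indicator of |β| = n + 1 bounds |γ|, so that k = |γ| - 1 lies in the range of
        -- summation.
        ≈⟨ 𝟏-⊗-cong (sum β ℕ.≟ suc n) (λ ∑β≡ → R.*-congˡ (∑-sign (suc n) γ
             (ℕ.≤-trans (ℕ.m≤m+n (sum γ) (sum δ)) (ℕ.≤-reflexive (trans γδ≡β ∑β≡))))) ⟩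
      𝟏 (sum β ℕ.≟ suc n) ⊗ ((qPoch n ⊗ ∏ δ qPoch⁻¹) ⊗
        (𝟏 (0 ℕ.≟ sum γ) ⊖ 𝟏 (squarefree? γ) ⊗ sign (sum γ)))
        ≈⟨ solve 4 (λ i p l s → i :* ((p :* l) :* s) := i :* p :* (s :* l)) ≐-refl _ _ _ _ ⟩
      𝟏 (sum β ℕ.≟ suc n) ⊗ qPoch n ⊗
        ((𝟏 (0 ℕ.≟ sum γ) ⊖ 𝟏 (squarefree? γ) ⊗ sign (sum γ)) ⊗ ∏ δ qPoch⁻¹) ∎

    -- Given |γ| = k + 1, the conditions |δ| = n - k and |β| = n + 1 agree. The second one does not
    -- depend on the factorisation and can leave the sum.
    degrees : ∀ {k} → k ≤ n → ∀ γ δ → sum γ + sum δ ≡ sum β →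
      𝟏 (sum γ ℕ.≟ suc k) ⊗ 𝟏 (sum δ ℕ.≟ n ∸ k) ≐ 𝟏 (sum γ ℕ.≟ suc k) ⊗ 𝟏 (sum β ℕ.≟ suc n)
    degrees {k} k≤n γ δ γδ≡β = 𝟏-⊗-cong (sum γ ℕ.≟ suc k) λ ∑γ≡ →
      𝟏-cong (sum δ ℕ.≟ n ∸ k) (sum β ℕ.≟ suc n)
        (λ ∑δ≡ → trans (sym γδ≡β) (trans (cong₂ _+_ ∑γ≡ ∑δ≡) (cong suc (ℕ.m+[n∸m]≡n k≤n))))
        (λ ∑β≡ → ℕ.+-cancelˡ-≡ (suc k) (sum δ) (n ∸ k) (trans (cong (λ s → s + sum δ) (sym ∑γ≡))
          (trans γδ≡β (trans ∑β≡ (cong suc (sym (ℕ.m+[n∸m]≡n k≤n)))))))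

    term : ∀ k → k ≤ n → ∀ γ δ → sum γ + sum δ ≡ sum β →
      (sign k ⊗ qPoch k ⊗ qbinom k) ⊗
        ((𝟏 (squarefree? γ) ⊗ 𝟏 (sum γ ℕ.≟ suc k)) ⊗ qMultinomial (n ∸ k) δ) ≐
      w δ ⊗ (𝟏 (sum γ ℕ.≟ suc k) ⊗ (𝟏 (squarefree? γ) ⊗ sign k))
    term k k≤n γ δ γδ≡β = begin
      (sign k ⊗ qPoch k ⊗ qbinom k) ⊗ ((𝟏 (squarefree? γ) ⊗ 𝟏 (sum γ ℕ.≟ suc k)) ⊗
        (𝟏 (sum δ ℕ.≟ n ∸ k) ⊗ (qPoch (n ∸ k) ⊗ ∏ δ qPoch⁻¹)))
        ≈⟨ solve 8 (λ s p b f i j r l → (s :* p :* b) :* ((f :* i) :* (j :* (r :* l))) :=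
                      (i :* j) :* ((p :* b :* r) :* (f :* s :* l))) ≐-refl
             (sign k) (qPoch k) (qbinom k) (𝟏 (squarefree? γ)) (𝟏 (sum γ ℕ.≟ suc k))
             (𝟏 (sum δ ℕ.≟ n ∸ k)) (qPoch (n ∸ k)) (∏ δ qPoch⁻¹) ⟩
      (𝟏 (sum γ ℕ.≟ suc k) ⊗ 𝟏 (sum δ ℕ.≟ n ∸ k)) ⊗
        ((qPoch k ⊗ qbinom k ⊗ qPoch (n ∸ k)) ⊗ (𝟏 (squarefree? γ) ⊗ sign k ⊗ ∏ δ qPoch⁻¹))
        ≈⟨ R.*-cong (degrees k≤n γ δ γδ≡β) (R.*-congʳ (hyp k)) ⟩
      (𝟏 (sum γ ℕ.≟ suc k) ⊗ 𝟏 (sum β ℕ.≟ suc n)) ⊗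
        (qPoch n ⊗ (𝟏 (squarefree? γ) ⊗ sign k ⊗ ∏ δ qPoch⁻¹))
        ≈⟨ solve 6 (λ i j p f s l → (i :* j) :* (p :* (f :* s :* l)) := (j :* (p :* l)) :* (i :* (f :* s)))
             ≐-refl (𝟏 (sum γ ℕ.≟ suc k)) (𝟏 (sum β ℕ.≟ suc n)) (qPoch n) (𝟏 (squarefree? γ)) (sign k)
             (∏ δ qPoch⁻¹) ⟩
      w δ ⊗ (𝟏 (sum γ ℕ.≟ suc k) ⊗ (𝟏 (squarefree? γ) ⊗ sign k)) ∎

-- The ring ℤ[[q]]

open import Data.Integer.Base using (_^_)
open import Defs

infix 4 _≐_

-- The wrapper keeps f and g visible as arguments of the type; in a bare pointwise equality the
-- operations on them would unfold.
record _≐_ (f g : ℤ⟦q⟧) : Set where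
  constructor coeffwise
  field coeff : ∀ k → f k ≡ g k
open _≐_

tail : ℤ⟦q⟧ → ℤ⟦q⟧
tail f = f ∘ suc

∑ℤ-applyUpTo : ∀ {A : Set} (g : ℕ → A) (h : A → ℤ) n →
               ∑ℤ (applyUpTo g n) h ≡ ∑ℤ (upTo n) (h ∘ g)
∑ℤ-applyUpTo g h n = go g id n
  where
  go : ∀ (g : ℕ → _) (j : ℕ → ℕ) n →
       ∑ℤ (applyUpTo (g ∘ j) n) h ≡ ∑ℤ (applyUpTo j n) (h ∘ g)
  go g j zero    = refl
  go g j (suc n) = cong (ℤ._+_ (h (g (j 0)))) (go g (j ∘ suc) n)

-- From f = f₀ + q · tail f. Products are thus computed by recursion on the degree, and the ring
-- laws follow by induction instead of by rearranging double sums.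
⊗-suc : ∀ f g n → (f ⊗ g) (suc n) ≡ f 0 ℤ.* g (suc n) ℤ.+ (tail f ⊗ g) n
⊗-suc f g n = cong (ℤ._+_ (f 0 ℤ.* g (suc n))) (∑ℤ-applyUpTo suc (λ i → f i ℤ.* g (suc n ∸ i)) (suc n))

⊗-zero : ∀ f g → (f ⊗ g) 0 ≡ f 0 ℤ.* g 0
⊗-zero f g = ℤ.+-identityʳ _

⊗-sucʳ : ∀ f g n → (f ⊗ g) (suc n) ≡ f (suc n) ℤ.* g 0 ℤ.+ (f ⊗ tail g) n
⊗-sucʳ f g zero = begin
  (f ⊗ g) 1                                ≡⟨ ⊗-suc f g 0 ⟩
  f 0 ℤ.* g 1 ℤ.+ (tail f ⊗ g) 0           ≡⟨ cong (ℤ._+_ (f 0 ℤ.* g 1)) (⊗-zero (tail f) g) ⟩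
  f 0 ℤ.* g 1 ℤ.+ f 1 ℤ.* g 0              ≡⟨ ℤ.+-comm (f 0 ℤ.* g 1) _ ⟩
  f 1 ℤ.* g 0 ℤ.+ f 0 ℤ.* g 1              ≡⟨ cong (ℤ._+_ (f 1 ℤ.* g 0)) (⊗-zero f (tail g)) ⟨
  f 1 ℤ.* g 0 ℤ.+ (f ⊗ tail g) 0           ∎
  where open ≡-Reasoning
⊗-sucʳ f g (suc n) = begin
  (f ⊗ g) (suc (suc n))
    ≡⟨ ⊗-suc f g (suc n) ⟩
  a ℤ.+ (tail f ⊗ g) (suc n)
    ≡⟨ cong (ℤ._+_ a) (⊗-sucʳ (tail f) g n) ⟩
  a ℤ.+ (b ℤ.+ c)
    ≡⟨ solve 3 (λ a b c → a :+ (b :+ c) := b :+ (a :+ c)) refl a b c ⟩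
  b ℤ.+ (a ℤ.+ c)
    ≡⟨ cong (ℤ._+_ b) (⊗-suc f (tail g) n) ⟨
  b ℤ.+ (f ⊗ tail g) (suc n) ∎
  where
  open ≡-Reasoning
  open +-*-Solver
  a = f 0 ℤ.* g (suc (suc n))
  b = f (suc (suc n)) ℤ.* g 0
  c = (tail f ⊗ tail g) n

-- The coefficient of q^n sees only degrees up to n. This locality allows `recip` to be replaced by
-- a truncated sum.
⊗-cong-≤ : ∀ {f f′ g g′} n → (∀ k → k ≤ n → f k ≡ f′ k) → (∀ k → k ≤ n → g k ≡ g′ k) →
           (f ⊗ g) n ≡ (f′ ⊗ g′) n
⊗-cong-≤ zero p r = cong (ℤ._+ 0ℤ) (cong₂ ℤ._*_ (p 0 z≤n) (r 0 z≤n))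
⊗-cong-≤ {f} {f′} {g} {g′} (suc n) p r = begin
  (f ⊗ g) (suc n)                               ≡⟨ ⊗-suc f g n ⟩
  f 0 ℤ.* g (suc n) ℤ.+ (tail f ⊗ g) n
    ≡⟨ cong₂ ℤ._+_ (cong₂ ℤ._*_ (p 0 z≤n) (r (suc n) ℕ.≤-refl))
         (⊗-cong-≤ n (λ k k≤n → p (suc k) (s≤s k≤n)) (λ k k≤n → r k (ℕ.m≤n⇒m≤1+n k≤n))) ⟩
  f′ 0 ℤ.* g′ (suc n) ℤ.+ (tail f′ ⊗ g′) n      ≡⟨ ⊗-suc f′ g′ n ⟨
  (f′ ⊗ g′) (suc n)                             ∎
  where open ≡-Reasoning

⊗-comm : ∀ f g n → (f ⊗ g) n ≡ (g ⊗ f) n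
⊗-comm f g zero    = cong (ℤ._+ 0ℤ) (ℤ.*-comm (f 0) (g 0))
⊗-comm f g (suc n) = begin
  (f ⊗ g) (suc n)                           ≡⟨ ⊗-suc f g n ⟩
  f 0 ℤ.* g (suc n) ℤ.+ (tail f ⊗ g) n      ≡⟨ cong₂ ℤ._+_ (ℤ.*-comm (f 0) _) (⊗-comm (tail f) g n) ⟩
  g (suc n) ℤ.* f 0 ℤ.+ (g ⊗ tail f) n      ≡⟨ ⊗-sucʳ g f n ⟨
  (g ⊗ f) (suc n)                           ∎
  where open ≡-Reasoning

⊗-scaleˡ : ∀ c f g n → ((λ k → c ℤ.* f k) ⊗ g) n ≡ c ℤ.* (f ⊗ g) n
⊗-scaleˡ c f g zero = solve 3 (λ c x y → c :* x :* y :+ con 0ℤ := c :* (x :* y :+ con 0ℤ)) refl c (f 0) (g 0)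
  where open +-*-Solver
⊗-scaleˡ c f g (suc n) = begin
  ((λ k → c ℤ.* f k) ⊗ g) (suc n)
    ≡⟨ ⊗-suc (λ k → c ℤ.* f k) g n ⟩
  c ℤ.* f 0 ℤ.* g (suc n) ℤ.+ ((λ k → c ℤ.* f (suc k)) ⊗ g) n
    ≡⟨ cong (ℤ._+_ (c ℤ.* f 0 ℤ.* g (suc n))) (⊗-scaleˡ c (tail f) g n) ⟩
  c ℤ.* f 0 ℤ.* g (suc n) ℤ.+ c ℤ.* (tail f ⊗ g) n
    ≡⟨ solve 4 (λ c x y z → c :* x :* y :+ c :* z := c :* (x :* y :+ z)) refl c (f 0) (g (suc n)) _ ⟩
  c ℤ.* (f 0 ℤ.* g (suc n) ℤ.+ (tail f ⊗ g) n)
    ≡⟨ cong (ℤ._*_ c) (⊗-suc f g n) ⟨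
  c ℤ.* (f ⊗ g) (suc n) ∎
  where
  open ≡-Reasoning
  open +-*-Solver

⊗-distribʳ : ∀ h f g n → ((f ⊕ g) ⊗ h) n ≡ (f ⊗ h ⊕ g ⊗ h) n
⊗-distribʳ h f g zero =
  solve 3 (λ x y z → (x :+ y) :* z :+ con 0ℤ := (x :* z :+ con 0ℤ) :+ (y :* z :+ con 0ℤ)) refl (f 0) (g 0) (h 0)
  where open +-*-Solver
⊗-distribʳ h f g (suc n) = begin
  ((f ⊕ g) ⊗ h) (suc n)
    ≡⟨ ⊗-suc (f ⊕ g) h n ⟩
  (f 0 ℤ.+ g 0) ℤ.* h (suc n) ℤ.+ (tail (f ⊕ g) ⊗ h) n
    ≡⟨ cong (ℤ._+_ ((f 0 ℤ.+ g 0) ℤ.* h (suc n))) (⊗-distribʳ h (tail f) (tail g) n) ⟩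
  (f 0 ℤ.+ g 0) ℤ.* h (suc n) ℤ.+ ((tail f ⊗ h) n ℤ.+ (tail g ⊗ h) n)
    ≡⟨ solve 5 (λ x y z u v → (x :+ y) :* z :+ (u :+ v) := (x :* z :+ u) :+ (y :* z :+ v)) refl
         (f 0) (g 0) (h (suc n)) _ _ ⟩
  (f 0 ℤ.* h (suc n) ℤ.+ (tail f ⊗ h) n) ℤ.+ (g 0 ℤ.* h (suc n) ℤ.+ (tail g ⊗ h) n)
    ≡⟨ cong₂ ℤ._+_ (⊗-suc f h n) (⊗-suc g h n) ⟨
  (f ⊗ h ⊕ g ⊗ h) (suc n) ∎
  where
  open ≡-Reasoning
  open +-*-Solver

⊗-assoc : ∀ f g h n → ((f ⊗ g) ⊗ h) n ≡ (f ⊗ (g ⊗ h)) n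
⊗-assoc f g h zero =
  solve 3 (λ x y z → (x :* y :+ con 0ℤ) :* z :+ con 0ℤ := x :* (y :* z :+ con 0ℤ) :+ con 0ℤ) refl (f 0) (g 0) (h 0)
  where open +-*-Solver
⊗-assoc f g h (suc n) = begin
  ((f ⊗ g) ⊗ h) (suc n)
    ≡⟨ ⊗-suc (f ⊗ g) h n ⟩
  (f ⊗ g) 0 ℤ.* h (suc n) ℤ.+ (tail (f ⊗ g) ⊗ h) n
    -- By `⊗-suc`, tail (f ⊗ g) = f₀ · tail g + tail f ⊗ g.
    ≡⟨ cong₂ (λ x y → x ℤ.* h (suc n) ℤ.+ y) (⊗-zero f g)
         (⊗-cong-≤ {g = h} n (λ k _ → ⊗-suc f g k) (λ _ _ → refl)) ⟩
  f 0 ℤ.* g 0 ℤ.* h (suc n) ℤ.+ (((λ k → f 0 ℤ.* g (suc k)) ⊕ (tail f ⊗ g)) ⊗ h) n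
    ≡⟨ cong (ℤ._+_ (f 0 ℤ.* g 0 ℤ.* h (suc n))) (⊗-distribʳ h (λ k → f 0 ℤ.* g (suc k)) (tail f ⊗ g) n) ⟩
  f 0 ℤ.* g 0 ℤ.* h (suc n) ℤ.+ (((λ k → f 0 ℤ.* g (suc k)) ⊗ h) n ℤ.+ ((tail f ⊗ g) ⊗ h) n)
    ≡⟨ cong₂ (λ x y → f 0 ℤ.* g 0 ℤ.* h (suc n) ℤ.+ (x ℤ.+ y))
         (⊗-scaleˡ (f 0) (tail g) h n) (⊗-assoc (tail f) g h n) ⟩
  f 0 ℤ.* g 0 ℤ.* h (suc n) ℤ.+ (f 0 ℤ.* (tail g ⊗ h) n ℤ.+ (tail f ⊗ (g ⊗ h)) n)
    ≡⟨ solve 5 (λ x y z u v → x :* y :* z :+ (x :* u :+ v) := x :* (y :* z :+ u) :+ v) refl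
         (f 0) (g 0) (h (suc n)) _ _ ⟩
  f 0 ℤ.* (g 0 ℤ.* h (suc n) ℤ.+ (tail g ⊗ h) n) ℤ.+ (tail f ⊗ (g ⊗ h)) n
    ≡⟨ cong (λ x → f 0 ℤ.* x ℤ.+ (tail f ⊗ (g ⊗ h)) n) (⊗-suc g h n) ⟨
  f 0 ℤ.* (g ⊗ h) (suc n) ℤ.+ (tail f ⊗ (g ⊗ h)) n
    ≡⟨ ⊗-suc f (g ⊗ h) n ⟨
  (f ⊗ (g ⊗ h)) (suc n) ∎
  where
  open ≡-Reasoning
  open +-*-Solver

⊗-zeroˡ : ∀ f g → (∀ k → f k ≡ 0ℤ) → ∀ n → (f ⊗ g) n ≡ 0ℤ
⊗-zeroˡ f g f≡0 zero    = cong (λ x → x ℤ.* g 0 ℤ.+ 0ℤ) (f≡0 0)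
⊗-zeroˡ f g f≡0 (suc n) = trans (⊗-suc f g n)
  (cong₂ (λ x y → x ℤ.* g (suc n) ℤ.+ y) (f≡0 0) (⊗-zeroˡ (tail f) g (f≡0 ∘ suc) n))

const-⊗ : ∀ c f n → (const c ⊗ f) n ≡ c ℤ.* f n
const-⊗ c f zero    = ⊗-zero (const c) f
const-⊗ c f (suc n) = trans (⊗-suc (const c) f n)
  (trans (cong (ℤ._+_ (c ℤ.* f (suc n))) (⊗-zeroˡ (tail (const c)) f (λ _ → refl) n)) (ℤ.+-identityʳ _))

⊖_ : ℤ⟦q⟧ → ℤ⟦q⟧
(⊖ f) n = ℤ.- f n

const-0 : ∀ n → const 0ℤ n ≡ 0ℤ
const-0 zero    = refl
const-0 (suc n) = refl

⟦q⟧-algebra : ℤAlgebra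
⟦q⟧-algebra = record
  { K = ℤ⟦q⟧
  ; _≐_ = _≐_
  ; _⊕_ = _⊕_
  ; _⊗_ = _⊗_
  ; ⊖_ = ⊖_
  ; const = const
  ; isCommutativeRing = record
    { isRing = record
      { +-isAbelianGroup = record
        { isGroup = record
          { isMonoid = record
            { isSemigroup = record
              { isMagma = record
                { isEquivalence = record
                  { refl  = coeffwise λ _ → refl
                  ; sym   = λ p → coeffwise λ k → sym (coeff p k)
                  ; trans = λ p r → coeffwise λ k → trans (coeff p k) (coeff r k)
                  }
                ; ∙-cong = λ p r → coeffwise λ k → cong₂ ℤ._+_ (coeff p k) (coeff r k)
                }
              ; assoc = λ f g h → coeffwise λ k → ℤ.+-assoc (f k) (g k) (h k)
              }
            ; identity = (λ f → coeffwise λ k → trans (cong (ℤ._+ f k) (const-0 k)) (ℤ.+-identityˡ (f k)))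
                       , (λ f → coeffwise λ k → trans (cong (ℤ._+_ (f k)) (const-0 k)) (ℤ.+-identityʳ (f k)))
            }
          ; inverse = (λ f → coeffwise λ k → trans (ℤ.+-inverseˡ (f k)) (sym (const-0 k)))
                    , (λ f → coeffwise λ k → trans (ℤ.+-inverseʳ (f k)) (sym (const-0 k)))
          ; ⁻¹-cong = λ p → coeffwise λ k → cong ℤ.-_ (coeff p k)
          }
        ; comm = λ f g → coeffwise λ k → ℤ.+-comm (f k) (g k)
        }
      ; *-cong = λ p r → coeffwise λ k → ⊗-cong-≤ k (λ j _ → coeff p j) (λ j _ → coeff r j)
      ; *-assoc = λ f g h → coeffwise (⊗-assoc f g h)
      ; *-identity = (λ f → coeffwise λ k → trans (const-⊗ 1ℤ f k) (ℤ.*-identityˡ (f k)))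
                   , (λ f → coeffwise λ k → trans (⊗-comm f (const 1ℤ) k)
                                              (trans (const-⊗ 1ℤ f k) (ℤ.*-identityˡ (f k))))
      ; distrib = (λ h f g → coeffwise λ k → trans (⊗-comm h (f ⊕ g) k)
                     (trans (⊗-distribʳ h f g k) (cong₂ ℤ._+_ (⊗-comm f h k) (⊗-comm g h k))))
                , (λ h f g → coeffwise (⊗-distribʳ h f g))
      }
    ; *-comm = λ f g → coeffwise (⊗-comm f g)
    }
  ; const-+ = λ a b → coeffwise λ { zero → refl ; (suc _) → refl }
  ; const-* = λ a b → coeffwise λ
      { zero    → sym (⊗-zero (const a) (const b))
      ; (suc k) → sym (trans (const-⊗ a (const b) (suc k)) (ℤ.*-zeroʳ a)) }
  ; const-neg = λ a → coeffwise λ { zero → refl ; (suc _) → refl }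
  }

open Sums ⟦q⟧-algebra
open ContentSums ⟦q⟧-algebra
open ℤAlgebra ⟦q⟧-algebra
  using (module R; module ≐-Reasoning; ≐-refl; solve; _:=_; _:+_; _:*_; _:-_; :-_; con)

-- Inverses of series with constant term 1

pow-vanishes : ∀ u → u 0 ≡ 0ℤ → ∀ k n → n < k → pow u k n ≡ 0ℤ
pow-vanishes u u₀≡0 (suc k) zero    _         = cong (λ x → x ℤ.* pow u k 0 ℤ.+ 0ℤ) u₀≡0
pow-vanishes u u₀≡0 (suc k) (suc n) (s≤s n<k) = begin
  (u ⊗ pow u k) (suc n)                                  ≡⟨ ⊗-suc u (pow u k) n ⟩
  u 0 ℤ.* pow u k (suc n) ℤ.+ (tail u ⊗ pow u k) n
    ≡⟨ cong₂ (λ x y → x ℤ.* pow u k (suc n) ℤ.+ y) u₀≡0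
         (⊗-cong-≤ {f = tail u} {g′ = const 0ℤ} n (λ _ _ → refl)
           (λ j j≤n → trans (pow-vanishes u u₀≡0 k j (ℕ.≤-<-trans j≤n n<k)) (sym (const-0 j)))) ⟩
  0ℤ ℤ.+ (tail u ⊗ const 0ℤ) n                           ≡⟨ ℤ.+-identityˡ _ ⟩
  (tail u ⊗ const 0ℤ) n                                  ≡⟨ coeff (R.zeroʳ (tail u)) n ⟩
  const 0ℤ n                                             ≡⟨ const-0 n ⟩
  0ℤ ∎
  where open ≡-Reasoning

geometric : ∀ u k → (const 1ℤ ⊖ u) ⊗ ∑ (upTo k) (pow u) ≐ const 1ℤ ⊖ pow u k
geometric u zero    =
  solve 1 (λ u → (con 1ℤ :- u) :* con 0ℤ := con 1ℤ :- con 1ℤ) ≐-refl u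
geometric u (suc k) = begin
  (const 1ℤ ⊖ u) ⊗ ∑ (upTo (suc k)) (pow u)
    ≈⟨ R.*-congˡ {const 1ℤ ⊖ u} (∑-upTo-suc k (pow u)) ⟩
  (const 1ℤ ⊖ u) ⊗ (const 1ℤ ⊕ ∑ (upTo k) (λ j → u ⊗ pow u j))
    ≈⟨ R.*-congˡ {const 1ℤ ⊖ u} (R.+-congˡ {const 1ℤ} (R.sym (∑-⊗ˡ (upTo k) u (pow u)))) ⟩
  (const 1ℤ ⊖ u) ⊗ (const 1ℤ ⊕ u ⊗ ∑ (upTo k) (pow u))
    ≈⟨ solve 2 (λ u s → (con 1ℤ :- u) :* (con 1ℤ :+ u :* s) :=
                        (con 1ℤ :- u) :+ u :* ((con 1ℤ :- u) :* s)) ≐-refl u (∑ (upTo k) (pow u)) ⟩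
  (const 1ℤ ⊖ u) ⊕ u ⊗ ((const 1ℤ ⊖ u) ⊗ ∑ (upTo k) (pow u))
    ≈⟨ R.+-congˡ {const 1ℤ ⊖ u} (R.*-congˡ {u} (geometric u k)) ⟩
  (const 1ℤ ⊖ u) ⊕ u ⊗ (const 1ℤ ⊖ pow u k)
    ≈⟨ solve 2 (λ u p → (con 1ℤ :- u) :+ u :* (con 1ℤ :- p) := con 1ℤ :- u :* p) ≐-refl u (pow u k) ⟩
  const 1ℤ ⊖ pow u (suc k) ∎
  where open ≐-Reasoning

-- The powers beyond u^n start above degree n, so a longer sum has the same coefficient there.
∑-pow-stable : ∀ u → u 0 ≡ 0ℤ → ∀ k n → n < k → ∑ (upTo (suc n)) (pow u) n ≡ ∑ (upTo k) (pow u) n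
∑-pow-stable u u₀≡0 (suc k) n (s≤s n≤k) with ℕ.m≤n⇒m<n∨m≡n n≤k
... | inj₂ refl = refl
... | inj₁ n<k  = begin
  ∑ (upTo (suc n)) (pow u) n                        ≡⟨ ∑-pow-stable u u₀≡0 k n n<k ⟩
  ∑ (upTo k) (pow u) n                              ≡⟨ ℤ.+-identityʳ (∑ (upTo k) (pow u) n) ⟨
  ∑ (upTo k) (pow u) n ℤ.+ 0ℤ
    ≡⟨ cong₂ (λ x y → ∑ (upTo k) (pow u) n ℤ.+ (x ℤ.+ y)) (pow-vanishes u u₀≡0 k n n<k) (const-0 n) ⟨
  (∑ (upTo k) (pow u) ⊕ (pow u k ⊕ const 0ℤ)) n     ≡⟨ coeff (∑-++ (upTo k) (k ∷ []) (pow u)) n ⟨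
  ∑ (upTo k ∷ʳ k) (pow u) n                         ≡⟨ cong (λ is → ∑ is (pow u) n) (List.upTo-∷ʳ k) ⟩
  ∑ (upTo (suc k)) (pow u) n ∎
  where open ≡-Reasoning

recip-inverseʳ : ∀ g → g 0 ≡ 1ℤ → g ⊗ recip g ≐ const 1ℤ
recip-inverseʳ g g₀≡1 = coeffwise λ n → begin
  (g ⊗ recip g) n
    -- `recip g` is cut off differently in every degree. Up to degree n all these sums agree with
    -- the one of n + 1 terms, which is a finite geometric sum with error u^(n+1), invisible in
    -- degree n.
    ≡⟨ ⊗-cong-≤ {g = recip g} n (λ k _ → coeff g≐1-u k)
         (λ k k≤n → ∑-pow-stable u u₀≡0 (suc n) k (s≤s k≤n)) ⟩
  ((const 1ℤ ⊖ u) ⊗ ∑ (upTo (suc n)) (pow u)) n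
    ≡⟨ coeff (geometric u (suc n)) n ⟩
  const 1ℤ n ℤ.- pow u (suc n) n
    ≡⟨ cong (λ x → const 1ℤ n ℤ.- x) (pow-vanishes u u₀≡0 (suc n) n ℕ.≤-refl) ⟩
  const 1ℤ n ℤ.+ 0ℤ
    ≡⟨ ℤ.+-identityʳ _ ⟩
  const 1ℤ n ∎
  where
  open ≡-Reasoning
  u = const 1ℤ ⊖ g
  u₀≡0 : u 0 ≡ 0ℤ
  u₀≡0 = cong (λ x → 1ℤ ℤ.- x) g₀≡1
  g≐1-u : g ≐ const 1ℤ ⊖ u
  g≐1-u = solve 1 (λ g → g := con 1ℤ :- (con 1ℤ :- g)) ≐-refl g

qPoch₀ : ∀ k → qPoch k 0 ≡ 1ℤ
qPoch₀ zero    = refl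
qPoch₀ (suc k) = cong (λ x → x ℤ.* 1ℤ ℤ.+ 0ℤ) (qPoch₀ k)

qPoch⁻¹ : ℕ → ℤ⟦q⟧
qPoch⁻¹ k = recip (qPoch k)

qPoch-inverseʳ : ∀ k → qPoch k ⊗ qPoch⁻¹ k ≐ const 1ℤ
qPoch-inverseʳ k = recip-inverseʳ (qPoch k) (qPoch₀ k)

q^0 : q^ 0 ≐ const 1ℤ
q^0 = coeffwise λ { zero → refl ; (suc _) → refl }

q^-+ : ∀ a b → q^ (a + b) ≐ (q^ a) ⊗ (q^ b)
q^-+ zero    b = R.sym (R.trans (R.*-congʳ {q^ b} q^0) (R.*-identityˡ (q^ b)))
q^-+ (suc a) b = coeffwise λ
  { zero    → refl
  ; (suc n) → trans (coeff (q^-+ a b) n)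
                (sym (trans (⊗-suc (q^ suc a) (q^ b) n) (ℤ.+-identityˡ _))) }

-- The coefficients of LLT polynomials

ℤ-algebra : ℤAlgebra
ℤ-algebra = record
  { K = ℤ
  ; _≐_ = _≡_
  ; const = λ i → i
  ; isCommutativeRing = ℤ.+-*-isCommutativeRing
  ; const-+ = λ _ _ → refl
  ; const-* = λ _ _ → refl
  ; const-neg = λ _ → refl
  }

-- ℕ embeds into ℤ, so that the statistics can be compared as sums in ℤ.
dinv-coinv : ∀ {m} (c : Vec (Fin m) m) → dinv (zeroAreaPath m) c ≡ coinv c
dinv-coinv c = ℤ.+-injective (Dinv.const-dinv ℤ-algebra c)

⟦q⟧-qAlgebra : QAlgebra
⟦q⟧-qAlgebra = record
  { algebra       = ⟦q⟧-algebra
  ; q^_           = q^_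
  ; q^-0          = q^0
  ; q^-+          = q^-+
  ; qPoch         = qPoch
  ; qPoch-zero    = ≐-refl
  ; qPoch-suc     = λ _ → ≐-refl
  ; qPoch⁻¹       = qPoch⁻¹
  ; qPoch-inverse = qPoch-inverseʳ
  }

open QMultinomials ⟦q⟧-qAlgebra

∑ₓ-coefficient : ∀ {I : Set} (is : List I) (f : I → Series) β → ∑ₓ is f β ≐ ∑ is (λ i → f i β)
∑ₓ-coefficient []       f β = ≐-refl
∑ₓ-coefficient (i ∷ is) f β = R.+-congˡ {f i β} (∑ₓ-coefficient is f β)

-- The type of the words in `F α` mentions `sum α`. Stating the length and the descent set as
-- variables lets both equations be matched with `refl`, without transporting words.
F-sumOfWords : ∀ {m} α S → sum α ≡ m → partialSums α ≡ S → ∀ β →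
  F α β ≐ const (+ length (filter (λ w → hasMonomial? β w ×-dec fundamentalWord? S w)
                                  (words (allFin (length β)) m)))
F-sumOfWords α _ refl refl β = ≐-refl

𝟙-coefficient : ∀ β → 𝟙 β ≐ qMultinomial 0 β
𝟙-coefficient β = begin
  𝟏 (List.≡-dec ℕ._≟_ β (List.replicate (length β) 0))
    ≈⟨ 𝟏-cong (List.≡-dec ℕ._≟_ β (List.replicate (length β) 0)) (sum β ℕ.≟ 0)
         (λ eq → trans (cong sum eq) (sum-zeros (length β))) (zeros β) ⟩
  𝟏 (sum β ℕ.≟ 0)
    ≈⟨ R.*-identityʳ (𝟏 (sum β ℕ.≟ 0)) ⟨
  𝟏 (sum β ℕ.≟ 0) ⊗ const 1ℤ
    ≈⟨ 𝟏-⊗-cong (sum β ℕ.≟ 0) (λ ∑β≡0 → R.sym (R.trans (R.*-identityˡ (∏ β qPoch⁻¹)) (∏-zeros β ∑β≡0))) ⟩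
  qMultinomial 0 β ∎
  where
  open ≐-Reasoning
  sum-zeros : ∀ n → sum (List.replicate n 0) ≡ 0
  sum-zeros zero    = refl
  sum-zeros (suc n) = sum-zeros n
  zeros : ∀ β → sum β ≡ 0 → β ≡ List.replicate (length β) 0
  zeros []         _  = refl
  zeros (zero ∷ β) eq = cong (0 ∷_) (zeros β eq)
  ∏-zeros : ∀ β → sum β ≡ 0 → ∏ β qPoch⁻¹ ≐ const 1ℤ
  ∏-zeros []         _  = ≐-refl
  ∏-zeros (zero ∷ β) eq = R.trans (R.*-cong qPoch⁻¹0 (∏-zeros β eq)) (R.*-identityˡ (const 1ℤ))
    where
    qPoch⁻¹0 : qPoch⁻¹ 0 ≐ const 1ℤ
    qPoch⁻¹0 = R.trans (R.sym (R.*-identityˡ (qPoch⁻¹ 0))) (qPoch-inverseʳ 0)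

LLT[]-coefficient : ∀ {m} (D : DyckPath m) β →
  LLT[ D ] β ≐ ∑ (parkingFunctions D) (λ c → (q^ dinv D c) ⊗ F (pides D c) β)
LLT[]-coefficient D β = ∑ₓ-coefficient (parkingFunctions D) (λ c → (q^ dinv D c) • F (pides D c)) β

LLT-qMultinomial : ∀ m β → LLT m β ≐ qMultinomial m β
LLT-qMultinomial zero    β = 𝟙-coefficient β
LLT-qMultinomial (suc m) β = begin
  LLT (suc m) β
    ≈⟨ LLT[]-coefficient (zeroAreaPath (suc m)) β ⟩
  ∑ (parkingFunctions (zeroAreaPath (suc m))) (λ c → (q^ dinv (zeroAreaPath (suc m)) c) ⊗
    F (pides (zeroAreaPath (suc m)) c) β)
    ≈⟨ ∑-cong (parkingFunctions (zeroAreaPath (suc m))) (λ c → R.*-congˡ {q^ dinv (zeroAreaPath (suc m)) c}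
         (F-sumOfWords (pides (zeroAreaPath (suc m)) c) (descentSet c) (sum-pides c) (partialSums-pides c) β)) ⟩
  ∑ (parkingFunctions (zeroAreaPath (suc m))) (λ c → (q^ dinv (zeroAreaPath (suc m)) c) ⊗
    const (+ length (filter (λ w → hasMonomial? β w ×-dec fundamentalWord? (descentSet c) w)
                            (words (allFin (length β)) (suc m)))))
    ≈⟨ LLT-coefficient dinv-coinv m β ⟩
  qMultinomial (suc m) β ∎
  where
  open ≐-Reasoning

-- The denominator is a product of series with constant term 1, so `recip` inverts it.
qbinom-spec : ∀ n k → qPoch k ⊗ qbinom n k ⊗ qPoch (n ∸ k) ≐ qPoch n
qbinom-spec n k = begin
  qPoch k ⊗ (qPoch n ⊗ recip d) ⊗ qPoch (n ∸ k)
    ≈⟨ solve 4 (λ a p r b → a :* (p :* r) :* b := p :* ((a :* b) :* r)) ≐-refl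
         (qPoch k) (qPoch n) (recip d) (qPoch (n ∸ k)) ⟩
  qPoch n ⊗ (d ⊗ recip d)
    ≈⟨ R.*-congˡ {qPoch n} (recip-inverseʳ d d₀≡1) ⟩
  qPoch n ⊗ const 1ℤ
    ≈⟨ R.*-identityʳ (qPoch n) ⟩
  qPoch n ∎
  where
  open ≐-Reasoning
  d = qPoch k ⊗ qPoch (n ∸ k)
  d₀≡1 : d 0 ≡ 1ℤ
  d₀≡1 = trans (⊗-zero (qPoch k) (qPoch (n ∸ k))) (cong₂ ℤ._*_ (qPoch₀ k) (qPoch₀ (n ∸ k)))

theorem3p1 : ∀ (n : ℕ) → 2 ≤ n →
    LLT n ≈ ∑ₓ (map suc (upTo n)) (λ k →
    (const (-1ℤ ^ (k ∸ 1)) ⊗ qPoch (k ∸ 1) ⊗ qbinom (n ∸ 1) (k ∸ 1))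
    • (e k ⊠ LLT (n ∸ k)))
theorem3p1 (suc n) _ β = coeff (begin
  LLT (suc n) β
    ≈⟨ LLT-qMultinomial (suc n) β ⟩
  qMultinomial (suc n) β
    ≈⟨ recurrence n (qbinom n) (qbinom-spec n) β ⟩
  ∑ (upTo (suc n)) (λ k → c k ⊗ ∑ (factorisations β) λ p →
    (𝟏 (squarefree? (proj₁ p)) ⊗ 𝟏 (sum (proj₁ p) ℕ.≟ suc k)) ⊗ qMultinomial (n ∸ k) (proj₂ p))
    ≈⟨ ∑-cong (upTo (suc n)) (λ k → R.*-congˡ {c k} (∑-cong (factorisations β) λ p →
         R.*-cong (e-coefficient (suc k) (proj₁ p)) (LLT-qMultinomial (n ∸ k) (proj₂ p)))) ⟨
  ∑ (upTo (suc n)) (λ k → (c k • (e (suc k) ⊠ LLT (n ∸ k))) β)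
    -- The index of the theorem is `suc k`; its subtractions `suc k ∸ 1` and `suc n ∸ suc k` compute
    -- to k and n ∸ k.
    ≈⟨ ∑-map suc (upTo (suc n)) (λ k → series k β) ⟨
  ∑ (map suc (upTo (suc n))) (λ k → series k β)
    ≈⟨ ∑ₓ-coefficient (map suc (upTo (suc n))) series β ⟨
  ∑ₓ (map suc (upTo (suc n))) series β ∎)
  where
  open ≐-Reasoning
  c : ℕ → ℤ⟦q⟧
  c k = const (-1ℤ ^ k) ⊗ qPoch k ⊗ qbinom n k
  series : ℕ → Series
  series k = (const (-1ℤ ^ (k ∸ 1)) ⊗ qPoch (k ∸ 1) ⊗ qbinom n (k ∸ 1)) • (e k ⊠ LLT (suc n ∸ k))
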